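{- Let $u\in\mathcal{W}_n$ be a packed word of type $\mathbf{m}$ with $\ell$ classes. Then for every permutation $\sigma\in\mathfrak{S}_{\ell-1}$ we have $\mathrm{sw}_{\sigma}(u)=\mathrm{sw}(u)$, where $\mathrm{sw}(u)=\mathrm{sw}_{\mathrm{id}}(u)$.
   Context: Fix a positive integer $n$. Sites are the elements of $\mathbb{Z}/n\mathbb{Z}$, identified with $1,\dots,n$ and arranged cyclically (the site after $n$ is $1$). $\mathcal{W}_n$ is the set of words $u=u_1\cdots u_n$ with letters in $\{1,2,3,\dots\}$ (indices taken mod $n$); $1^n$ is the word all of whose letters are $1$. The type of $u$ is $\mathbf{m}=(m_1,m_2,\dots)$ where $m_i$ is the number of letters of $u$ equal to $i$; its number of classes is $\ell=\max\{i: m_i\neq 0\}$; $u$ (or $\mathbf m$) is packed if $m_i\neq0$ for all $1\le i\le \ell$. Put $p_i(\mathbf{m})=m_1+\cdots+m_i$ ($p_0=0$). A queue is a subset $q\subseteq\{1,\dots,n\}$; an $r$-queue is a queue of size $r$. For a queue $q$ and $u\in\mathcal{W}_n$ the word $v=q(u)$ is defined as follows: choose a permutation $(i_1,\dots,i_n)$ of $(1,\dots,n)$ with $u_{i_1}\le\cdots\le u_{i_n}$; initially no letter of $v$ is set. Phase I: for $i=i_n,i_{n-1},\dots,i_{|q|+1}$ (in this order), find the first site $j$ weakly to the left of $i$ (cyclically) with $j\notin q$ and $v_j$ not yet set, and set $v_j=u_i+1$. Phase II: for $i=i_1,i_2,\dots,i_{|q|}$ (in this order), find the first site $j$ weakly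 to the right of $i$ (cyclically) with $j\in q$ and $v_j$ not yet set, and set $v_j=u_i$. (The result does not depend on the choice of the permutation.) For $\sigma\in\mathfrak{S}_{\ell-1}$, a $\sigma$-twisted multiline queue (MLQ) of type $\mathbf m=(m_1,\dots,m_\ell,0,0,\dots)$ (with $p_\ell(\mathbf m)=n$) is a sequence $\mathbf q=(q_1,\dots,q_{\ell-1})$ where $q_i$ is a $p_{\sigma(i)}(\mathbf m)$-queue; it acts on words by $\mathbf q(u)=q_{\ell-1}(\cdots q_2(q_1(u))\cdots)$. With commuting indeterminates $x_1,\dots,x_n$ indexed by $\mathbb{Z}/n\mathbb{Z}$, the weight of a queue is $\mathrm{wt}(q)=\prod_{i\in q}x_i$ and $\mathrm{wt}(\mathbf q)=\prod_{i=1}^{\ell-1}\mathrm{wt}(q_i)$. For a packed word $u$ of type $\mathbf m$ with $\ell$ classes and $\sigma\in\mathfrak S_{\ell-1}$, the $\sigma$-spectral weight is $\mathrm{sw}_\sigma(u)=\sum_{\mathbf q}\mathrm{wt}(\mathbf q)$, summed over all $\sigma$-twisted MLQs $\mathbf q$ of type $\mathbf m$ with $\mathbf q(1^n)=u$. -}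

module Defs where

open import Level using (Level)
open import Data.Nat using (ℕ; zero; suc; _+_; _∸_; _≤_; _≤ᵇ_; _≡ᵇ_; _⊔_; NonZero)
open import Data.Nat.DivMod using (_%_; m%n<n)
open import Data.Bool using (Bool; true; false; if_then_else_; _∧_; not)
open import Data.Maybe using (Maybe; just; nothing)
open import Data.Fin using (Fin; toℕ; fromℕ<)
open import Data.Fin.Subset using (Subset; ∣_∣)
open import Data.Vec as V using (Vec; []; _∷_; lookup; _[_]≔_; replicate; tabulate; allFin)
open import Data.List as L using (List; []; _∷_; _++_; concatMap; filter; take; reverse; upTo)
open import Data.Product using (Σ; ∃; _×_; _,_)
open import Relation.Nullary using (Dec; yes; no; does)
open import Relation.Binary.PropositionalEquality using (_≡_)
open import Data.Fin.Permutation using (Permutation′; _⟨$⟩ʳ_)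
open import Algebra.Bundles using (CommutativeSemiring)

-- Words u = u_1 ⋯ u_n : sites are Fin n (site k+1 ↔ index k), letters in ℕ
Word : ℕ → Set
Word n = Vec ℕ n

ones : (n : ℕ) → Word n
ones n = replicate n 1

mult : ∀ {n} → Word n → ℕ → ℕ
mult u i = L.length (filter (λ j → lookup u j Data.Nat.≟ i) (V.toList (allFin _)))

p : ∀ {n} → Word n → ℕ → ℕ
p u zero    = 0
p u (suc i) = p u i + mult u (suc i)

classes : ∀ {n} → Word n → ℕ
classes u = V.foldr _ _⊔_ 0 u

-- u ∈ 𝒲_n (letters ≥ 1) and packed: m_i ≠ 0 for 1 ≤ i ≤ ℓ
Packed : ∀ {n} → Word n → Set
Packed {n} u = (∀ (j : Fin n) → 1 ≤ lookup u j)
             × (∀ i → 1 ≤ i → i ≤ classes u → ∃ λ (j : Fin n) → lookup u j ≡ i)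

insertBy : ∀ {n} → Word n → Fin n → List (Fin n) → List (Fin n)
insertBy u j [] = j ∷ []
insertBy u j (k ∷ ks) =
  if lookup u j ≤ᵇ lookup u k then j ∷ k ∷ ks else k ∷ insertBy u j ks

sortedSites : ∀ {n} → Word n → List (Fin n)
sortedSites {n} u = L.foldr (insertBy u) [] (V.toList (allFin n))

site : (n : ℕ) .{{_ : NonZero n}} → ℕ → Fin n
site n m = fromℕ< (m%n<n m n)

sameBool : Bool → Bool → Bool
sameBool true  b = b
sameBool false b = not b

firstFree : ∀ {n} → Subset n → Bool → Vec (Maybe ℕ) n → List (Fin n) → Maybe (Fin n)
firstFree q b v [] = nothing
firstFree q b v (j ∷ js) with lookup v j
... | just _  = firstFree q b v js
... | nothing = if sameBool (lookup q j) b then just j else firstFree q b v js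

leftOf : (n : ℕ) .{{_ : NonZero n}} → Fin n → List (Fin n)
leftOf n i = L.map (λ t → site n (toℕ i + n ∸ t)) (upTo n)

rightOf : (n : ℕ) .{{_ : NonZero n}} → Fin n → List (Fin n)
rightOf n i = L.map (λ t → site n (toℕ i + t)) (upTo n)

place : ∀ {n} → Maybe (Fin n) → ℕ → Vec (Maybe ℕ) n → Vec (Maybe ℕ) n
place nothing  a v = v
place (just j) a v = v [ j ]≔ just a

phaseI : (n : ℕ) .{{_ : NonZero n}} → Subset n → Word n → List (Fin n) → Vec (Maybe ℕ) n → Vec (Maybe ℕ) n
phaseI n q u [] v = v
phaseI n q u (i ∷ is) v =
  phaseI n q u is (place (firstFree q false v (leftOf n i)) (suc (lookup u i)) v)

phaseII : (n : ℕ) .{{_ : NonZero n}} → Subset n → Word n → List (Fin n) → Vec (Maybe ℕ) n → Vec (Maybe ℕ) n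
phaseII n q u [] v = v
phaseII n q u (i ∷ is) v =
  phaseII n q u is (place (firstFree q true v (rightOf n i)) (lookup u i) v)

unMaybe : Maybe ℕ → ℕ
unMaybe (just a) = a
unMaybe nothing  = 0

applyQueue : (n : ℕ) .{{_ : NonZero n}} → Subset n → Word n → Word n
applyQueue n q u =
  let s  = sortedSites u
      v₁ = phaseI n q u (take (n ∸ ∣ q ∣) (reverse s)) (replicate n nothing)
      v₂ = phaseII n q u (take ∣ q ∣ s) v₁
  in V.map unMaybe v₂

applyMLQ : (n : ℕ) .{{_ : NonZero n}} → ∀ {k} → Vec (Subset n) k → Word n → Word n
applyMLQ n []       u = u
applyMLQ n (q ∷ qs) u = applyMLQ n qs (applyQueue n q u)

allSubsets : (n : ℕ) → List (Subset n)
allSubsets zero    = [] ∷ []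
allSubsets (suc n) = concatMap (λ s → (true ∷ s) ∷ (false ∷ s) ∷ []) (allSubsets n)

allSeqs : (n k : ℕ) → List (Vec (Subset n) k)
allSeqs n zero    = [] ∷ []
allSeqs n (suc k) = concatMap (λ q → L.map (q ∷_) (allSeqs n k)) (allSubsets n)

-- 𝐪 is a σ-twisted MLQ of type 𝐦(u): q_i is a p_{σ(i)}-queue (i 1-based)
sizesOK : ∀ {n k} → Word n → Permutation′ k → Vec (Subset n) k → Bool
sizesOK u σ qs =
  V.foldr _ _∧_ true
    (V.zipWith (λ i q → ∣ q ∣ ≡ᵇ p u (suc (toℕ (σ ⟨$⟩ʳ i)))) (allFin _) qs)

wordEq : ∀ {n} → Word n → Word n → Bool
wordEq [] [] = true
wordEq (a ∷ as) (b ∷ bs) = (a ≡ᵇ b) ∧ wordEq as bs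

-- spectral weight, evaluated in an arbitrary commutative semiring R at x

module _ {c ℓ : Level} (R : CommutativeSemiring c ℓ) where
  open CommutativeSemiring R using (Carrier; 0#; 1#) renaming (_+_ to _+R_; _*_ to _*R_)


  wtQ : ∀ {n} → (Fin n → Carrier) → Subset n → Carrier
  wtQ x q = V.foldr _ _*R_ 1# (V.zipWith (λ i b → if b then x i else 1#) (allFin _) q)

  wtMLQ : ∀ {n k} → (Fin n → Carrier) → Vec (Subset n) k → Carrier
  wtMLQ x qs = V.foldr _ _*R_ 1# (V.map (wtQ x) qs)

  sw : (n : ℕ) .{{_ : NonZero n}} → (x : Fin n → Carrier) → (u : Word n)
     → Permutation′ (classes u ∸ 1) → Carrier
  sw n x u σ =
    L.foldr _+R_ 0#
      (L.map (wtMLQ x)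
        (L.filter (λ qs → Data.Bool.T? (sizesOK u σ qs ∧ wordEq (applyMLQ n qs (ones n)) u))
                  (allSeqs n (classes u ∸ 1))))

{-# OPTIONS --safe #-}

-- A word w is recorded by its threshold sets {w < k}.  A queue q inserts itself into this
-- chain (sorted by size) and replaces every other member B by q + ΔI, where I x is the
-- minimum over [x , x + n] of the periodic walk with steps B − q; for ∣B∣ ≤ ∣q∣ this is the
-- departure set of a cyclic queue with arrivals B and services q, and for ∣B∣ ≥ ∣q∣ the
-- complement of a queue running leftwards.
-- For two queues p , q with the analogous I of the walk X with steps p − q, put
-- p′ = p − ΔI and q′ = q + ΔI.  The Pitman-type identity
--     min_[a,b] (X − 2 I) = min_[a,b] X − I a − I b
-- shows that (p , q) ↦ (p′ , q′) is an involution, and, through the last-passage formula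
-- for two queues in tandem, that q ∘ p and q′ ∘ p′ act equally on every threshold set.
-- The involution preserves weights and interchanges the sizes, so neighbouring queue sizes
-- may be transposed in the sum defining the spectral weight.

module Submission where

open import Defs
open import Level using (Level)
open import Data.Nat as ℕ using (ℕ; zero; suc; _∸_; _≡ᵇ_; NonZero)
import Data.Nat.Properties as ℕ
open import Data.Nat.DivMod using (_%_; _/_; m%n<n; [m+n]%n≡m%n; m≡m%n+[m/n]*n; m<n⇒m%n≡m)
open import Data.Bool using (Bool; true; false; _∧_; not; if_then_else_; T?)
open import Data.Bool.Properties using (T-≡; not-involutive; ∧-comm) renaming (_≟_ to _≟ᵇ_)
open import Data.Maybe using (Maybe; just; nothing; maybe′)
open import Data.Maybe.Properties using (just-injective)
open import Data.Fin as Fin using (Fin; toℕ)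
open import Data.Fin.Permutation using (Permutation′; id; _⟨$⟩ʳ_; _⟨$⟩ˡ_; inverseˡ; inverseʳ)
open import Data.Fin.Properties as Fin using (toℕ-fromℕ<; toℕ-injective; toℕ<n; all?; ¬∀⟶∃¬) renaming (_≟_ to _≟ᶠ_)
open import Data.Fin.Subset using (Subset; ∣_∣)
open import Data.Fin.Subset.Properties using (∣p∣≤n)
open import Data.Integer as ℤ using (ℤ)
open import Data.Vec as V using (Vec; []; _∷_; lookup; tabulate; replicate; _[_]≔_)
open import Data.Vec.Properties as V using (lookup∘tabulate; tabulate∘lookup; tabulate-cong; lookup-map; lookup-replicate; lookup∘updateAt; lookup∘updateAt′)
open import Data.List as List using (List; []; _∷_; _++_; map; length; filterᵇ; filter; take; reverse; concatMap; cartesianProduct; applyUpTo)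
open import Data.List.Properties using (map-upTo; map-tabulate; length-take; take-all; unfold-reverse)
open import Data.List.Membership.Propositional using (_∈_)
open import Data.List.Membership.Propositional.Properties using (∈-applyUpTo⁺; ∈-map⁺; ∈-tabulate⁺; ∈-cartesianProduct⁺)
open import Data.List.Membership.Propositional.Properties.WithK using (unique∧set⇒bag)
open import Data.List.Relation.Unary.Any using (here; there)
open import Data.List.Relation.Unary.All as All using (All; []; _∷_)
import Data.List.Relation.Unary.All.Properties as All
open import Data.List.Relation.Unary.AllPairs as AllPairs using (AllPairs; []; _∷_)
import Data.List.Relation.Unary.AllPairs.Properties as AllPairs
open import Data.List.Relation.Unary.Unique.Propositional using (Unique)
import Data.List.Relation.Unary.Unique.Propositional.Properties as Unique
open import Data.List.Relation.Binary.BagAndSetEquality using (∼bag⇒↭)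
open import Data.List.Relation.Binary.Permutation.Propositional as Perm using (_↭_)
open import Data.List.Relation.Binary.Permutation.Propositional.Properties using () renaming (map⁺ to ↭-map⁺)
open import Data.Product using (∃; _×_; _,_; proj₁; proj₂)
open import Data.Sum using (_⊎_; inj₁; inj₂)
open import Function using (_∘_; flip; mk⇔; Equivalence)
open import Relation.Nullary using (¬_; yes; no; does; contradiction)
open import Relation.Nullary.Decidable using (dec-true; dec-false)
open import Relation.Binary.Definitions using (tri<; tri≈; tri>)
open import Relation.Binary.PropositionalEquality as ≡ using (_≡_; _≢_; refl; sym; trans; cong; cong₂; subst; subst₂)
open import Algebra.Bundles using (CommutativeSemiring)

-- On a circle no queue starts empty, so queue lengths have no initial value to be computed from. A
-- window of one full period replaces it: a single idle site in the period recovers all queue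
-- lengths from the walk. If there is none, the queue is saturated, the two sizes agree and I is
-- constant. The exchange works because the correction `I a + I b` in the Pitman-type identity sees
-- only the ends of the interval. In the last-passage formula, with the start x and the outer point
-- e fixed, the inner point runs over an interval whose ends contribute exactly as x and e do. The
-- share of e cancels the passage from p to p′ in B - p; the share of x cancels the passage from q
-- to q′. On words there is a further obstacle: phase I raises the letters it places, so a threshold
-- set keeps its index if it is smaller than the queue and moves up by one if it is larger. The two
-- sides of the exchange are therefore matched by size: a threshold set is followed according to
-- where its size lies relative to both queues.

-- Minima of integer walks on intervals.

module WindowMinimum where

  open import Data.Integer using (0ℤ; 1ℤ; _+_; _-_; -_; _⊓_; _≤_; _<_)
  open import Data.Integer.Properties renaming (_≟_ to _≟ᶻ_)
  open import Data.Integer.Solver using (module +-*-Solver)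
  open +-*-Solver

  -- The ring solver proves equations only. An inequality is therefore reduced to an equation
  -- between the difference of its sides and the differences of known inequalities.
  ≤-by : ∀ {a b p q} → p ≤ q → b - a ≡ q - p → a ≤ b
  ≤-by h e = 0≤i-j⇒j≤i (subst (0ℤ ≤_) (sym e) (i≤j⇒0≤j-i h))

  ≤-by₂ : ∀ {a b p q r s} → p ≤ q → r ≤ s → b - a ≡ (q - p) + (s - r) → a ≤ b
  ≤-by₂ h k e =
    0≤i-j⇒j≤i (subst (0ℤ ≤_) (sym e) (+-mono-≤ (i≤j⇒0≤j-i h) (i≤j⇒0≤j-i k)))

  ≡-by : ∀ {a b p q} → p ≡ q → b - a ≡ q - p → a ≡ b
  ≡-by h e = sym (i-j≡0⇒i≡j _ _ (trans e (i≡j⇒i-j≡0 (sym h))))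

  <⇒+1≤ : ∀ {i j} → i < j → i + 1ℤ ≤ j
  <⇒+1≤ {i} h = subst (_≤ _) (+-comm 1ℤ i) (i<j⇒suc[i]≤j h)

  -- A relation rather than a function: a minimum is carried over to another walk or interval by a
  -- bound and a minimiser, and `IsMin-unique` turns the result back into an equation.
  record IsMin (F : ℕ → ℤ) (a b : ℕ) (z : ℤ) : Set where
    constructor isMin
    field
      lower : ∀ c → a ℕ.≤ c → c ℕ.≤ b → z ≤ F c
      arg   : ℕ
      a≤arg : a ℕ.≤ arg
      arg≤b : arg ℕ.≤ b
      att   : F arg ≡ z

  open IsMin

  IsMin-unique : ∀ {F a b z z′} → IsMin F a b z → IsMin F a b z′ → z ≡ z′
  IsMin-unique m m′ = ≤-antisym
    (subst (_ ≤_) (att m′) (lower m (arg m′) (a≤arg m′) (arg≤b m′)))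
    (subst (_ ≤_) (att m) (lower m′ (arg m) (a≤arg m) (arg≤b m)))

  minOn : (ℕ → ℤ) → ℕ → ℕ → ℤ
  minOn F a zero    = F a
  minOn F a (suc k) = F a ⊓ minOn F (suc a) k

  minOn-isMin : ∀ F a k → IsMin F a (a ℕ.+ k) (minOn F a k)
  minOn-isMin F a zero = isMin
    (λ c p q → ≤-reflexive (cong F (ℕ.≤-antisym p (subst (c ℕ.≤_) (ℕ.+-identityʳ a) q))))
    a ℕ.≤-refl (ℕ.m≤m+n a 0) refl
  minOn-isMin F a (suc k) = isMin low (proj₁ at) (proj₁ (proj₂ at)) (proj₁ (proj₂ (proj₂ at))) (proj₂ (proj₂ (proj₂ at)))
    where
    ih = minOn-isMin F (suc a) k
    low : ∀ c → a ℕ.≤ c → c ℕ.≤ a ℕ.+ suc k → F a ⊓ minOn F (suc a) k ≤ F c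
    low c p q with ℕ.m≤n⇒m<n∨m≡n p
    ... | inj₁ a<c = ≤-trans (i⊓j≤j (F a) _) (lower ih c a<c (subst (c ℕ.≤_) (ℕ.+-suc a k) q))
    ... | inj₂ refl = i⊓j≤i (F a) _
    at : ∃ λ c → a ℕ.≤ c × c ℕ.≤ a ℕ.+ suc k × F c ≡ F a ⊓ minOn F (suc a) k
    at with ⊓-sel (F a) (minOn F (suc a) k)
    ... | inj₁ e = a , ℕ.≤-refl , ℕ.m≤m+n a (suc k) , sym e
    ... | inj₂ e = arg ih , ℕ.≤-trans (ℕ.n≤1+n a) (a≤arg ih)
                 , subst (arg ih ℕ.≤_) (sym (ℕ.+-suc a k)) (arg≤b ih) , trans (att ih) (sym e)

  exists-min : ∀ F {a b} → a ℕ.≤ b → ∃ (IsMin F a b)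
  exists-min F {a} {b} p =
    minOn F a (b ℕ.∸ a) , subst (λ b′ → IsMin F a b′ (minOn F a (b ℕ.∸ a))) (ℕ.m+[n∸m]≡n p) (minOn-isMin F a (b ℕ.∸ a))

  -- Discrete intermediate values: steps that fall by at most one cannot jump over `t`. The point
  -- found is the first one, whence the bound on everything before it.
  first-hit : ∀ (Y : ℕ → ℤ) t → (∀ x → Y x ≤ Y (suc x) + 1ℤ) →
              ∀ a k → t ≤ Y a → Y (a ℕ.+ k) < t →
              ∃ λ c → a ℕ.≤ c × c ℕ.≤ a ℕ.+ k × Y c ≡ t × (∀ d → a ℕ.≤ d → d ℕ.≤ c → t ≤ Y d)
  first-hit Y t down a k ta kt with t ≟ᶻ Y a
  ... | yes e = a , ℕ.≤-refl , ℕ.m≤m+n a k , sym e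
              , λ d p q → subst (λ x → t ≤ Y x) (ℕ.≤-antisym p q) ta
  first-hit Y t down a zero ta kt | no _ =
    contradiction (<-≤-trans (subst (λ x → Y x < t) (ℕ.+-identityʳ a) kt) ta) (<-irrefl refl)
  first-hit Y t down a (suc k) ta kt | no ne
    with first-hit Y t down (suc a) k
           (≤-by₂ (<⇒+1≤ (≤∧≢⇒< ta ne)) (down a)
             (solve 3 (λ t y z → z :- t := (y :- (t :+ con 1ℤ)) :+ ((z :+ con 1ℤ) :- y)) refl t (Y a) (Y (suc a))))
           (subst (λ x → Y x < t) (ℕ.+-suc a k) kt)
  ... | c , p , q , e , h = c , ℕ.≤-trans (ℕ.n≤1+n a) p , subst (c ℕ.≤_) (sym (ℕ.+-suc a k)) q , e , h′
    where
    h′ : ∀ d → a ℕ.≤ d → d ℕ.≤ c → t ≤ Y d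
    h′ d r s with ℕ.m≤n⇒m<n∨m≡n r
    ... | inj₁ a<d = h d a<d s
    ... | inj₂ refl = ta

  -- The mirror image, read from the right end: it is now the rises that are at most one.
  last-hit : ∀ (Y : ℕ → ℤ) t → (∀ x → Y (suc x) ≤ Y x + 1ℤ) →
             ∀ a k → t ≤ Y (a ℕ.+ k) → Y a < t →
             ∃ λ c → a ℕ.≤ c × c ℕ.≤ a ℕ.+ k × Y c ≡ t × (∀ d → c ℕ.≤ d → d ℕ.≤ a ℕ.+ k → t ≤ Y d)
  last-hit Y t up a k tk at with t ≟ᶻ Y (a ℕ.+ k)
  ... | yes e = a ℕ.+ k , ℕ.m≤m+n a k , ℕ.≤-refl , sym e
              , λ d p q → subst (λ x → t ≤ Y x) (ℕ.≤-antisym p q) tk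
  last-hit Y t up a zero tk at | no _ =
    contradiction (<-≤-trans at (subst (λ x → t ≤ Y x) (ℕ.+-identityʳ a) tk)) (<-irrefl refl)
  last-hit Y t up a (suc k) tk at | no ne
    with last-hit Y t up a k
           (≤-by₂ (<⇒+1≤ (≤∧≢⇒< tk ne))
                  (subst (λ x → Y x ≤ Y (a ℕ.+ k) + 1ℤ) (sym (ℕ.+-suc a k)) (up (a ℕ.+ k)))
             (solve 3 (λ t y z → z :- t := (y :- (t :+ con 1ℤ)) :+ ((z :+ con 1ℤ) :- y)) refl
               t (Y (a ℕ.+ suc k)) (Y (a ℕ.+ k)))) at
  ... | c , p , q , e , h = c , p , ℕ.≤-trans q (ℕ.+-monoʳ-≤ a (ℕ.n≤1+n k)) , e , h′
    where
    h′ : ∀ d → c ℕ.≤ d → d ℕ.≤ a ℕ.+ suc k → t ≤ Y d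
    h′ d r s with ℕ.m≤n⇒m<n∨m≡n s
    ... | inj₁ d<  = h d r (ℕ.≤-pred (subst (suc d ℕ.≤_) (ℕ.+-suc a k) d<))
    ... | inj₂ refl = tk

  -- The Pitman-type identity for a walk with drift `δ` per period.

  module Pitman (n : ℕ) .{{_ : NonZero n}} (X : ℕ → ℤ) (δ : ℤ)
                (per  : ∀ x → X (x ℕ.+ n) ≡ X x + δ)
                (down : ∀ x → X x ≤ X (suc x) + 1ℤ)
                (up   : ∀ x → X (suc x) ≤ X x + 1ℤ) where

    I : ℕ → ℤ
    I x = minOn X x n

    I-isMin : ∀ x → IsMin X x (x ℕ.+ n) (I x)
    I-isMin x = minOn-isMin X x n

    I-greatest : ∀ {z} x → (∀ c → x ℕ.≤ c → c ℕ.≤ x ℕ.+ n → z ≤ X c) → z ≤ I x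
    I-greatest x h = let m = I-isMin x in
      subst (_ ≤_) (att m) (h (arg m) (a≤arg m) (arg≤b m))

    I≤X : ∀ x → I x ≤ X x
    I≤X x = lower (I-isMin x) x ℕ.≤-refl (ℕ.m≤m+n x n)

    I≤X+δ : ∀ x → I x ≤ X x + δ
    I≤X+δ x = subst (I x ≤_) (per x) (lower (I-isMin x) (x ℕ.+ n) (ℕ.m≤m+n x n) ℕ.≤-refl)

    I-periodic : ∀ x → I (x ℕ.+ n) ≡ I x + δ
    I-periodic x = ≤-antisym ge le
      where
      m = I-isMin x
      ge : I (x ℕ.+ n) ≤ I x + δ
      ge = subst (I (x ℕ.+ n) ≤_) (trans (per (arg m)) (cong (_+ δ) (att m)))
             (lower (I-isMin (x ℕ.+ n)) (arg m ℕ.+ n) (ℕ.+-monoˡ-≤ n (a≤arg m)) (ℕ.+-monoˡ-≤ n (arg≤b m)))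
      le : I x + δ ≤ I (x ℕ.+ n)
      le = I-greatest (x ℕ.+ n) λ c p q →
        let c≥n = ℕ.≤-trans (ℕ.m≤n+m n x) p
            e   = ℕ.m∸n+n≡m c≥n in
        subst (I x + δ ≤_) (trans (sym (per (c ℕ.∸ n))) (cong X e))
          (+-monoˡ-≤ δ (lower m (c ℕ.∸ n)
            (ℕ.+-cancelʳ-≤ n _ _ (subst (x ℕ.+ n ℕ.≤_) (sym e) p))
            (ℕ.+-cancelʳ-≤ n _ _ (subst (ℕ._≤ x ℕ.+ n ℕ.+ n) (sym e) q))))

    mono⁻ : δ ≤ 0ℤ → ∀ x → I (suc x) ≤ I x
    mono⁻ δ≤0 x = I-greatest x low
      where
      low : ∀ c → x ℕ.≤ c → c ℕ.≤ x ℕ.+ n → I (suc x) ≤ X c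
      low c p q with ℕ.m≤n⇒m<n∨m≡n p
      ... | inj₁ x<c = lower (I-isMin (suc x)) c x<c (ℕ.m≤n⇒m≤1+n q)
      ... | inj₂ refl = ≤-trans
        (subst (I (suc x) ≤_) (per x)
          (lower (I-isMin (suc x)) (x ℕ.+ n) (ℕ.m<m+n x (ℕ.>-nonZero⁻¹ n)) (ℕ.n≤1+n _)))
        (subst (X x + δ ≤_) (+-identityʳ _) (+-monoʳ-≤ (X x) δ≤0))

    mono⁺ : 0ℤ ≤ δ → ∀ x → I x ≤ I (suc x)
    mono⁺ 0≤δ x = I-greatest (suc x) low
      where
      low : ∀ c → suc x ℕ.≤ c → c ℕ.≤ suc x ℕ.+ n → I x ≤ X c
      low c p q with ℕ.m≤n⇒m<n∨m≡n q
      ... | inj₁ c<  = lower (I-isMin x) c (ℕ.<⇒≤ p) (ℕ.≤-pred c<)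
      ... | inj₂ refl = ≤-trans
        (lower (I-isMin x) (suc x) (ℕ.n≤1+n x)
          (subst (ℕ._≤ x ℕ.+ n) (ℕ.+-comm x 1) (ℕ.+-monoʳ-≤ x (ℕ.>-nonZero⁻¹ n))))
        (subst (X (suc x) ≤_) (sym (per (suc x)))
          (subst (_≤ X (suc x) + δ) (+-identityʳ _) (+-monoʳ-≤ (X (suc x)) 0≤δ)))

    mono⁻* : δ ≤ 0ℤ → ∀ {x y} → x ℕ.≤ y → I y ≤ I x
    mono⁻* h {x} p = go (ℕ.≤⇒≤′ p)
      where
      go : ∀ {y} → x ℕ.≤′ y → I y ≤ I x
      go ℕ.≤′-refl     = ≤-refl
      go (ℕ.≤′-step q) = ≤-trans (mono⁻ h _) (go q)

    mono⁺* : 0ℤ ≤ δ → ∀ {x y} → x ℕ.≤ y → I x ≤ I y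
    mono⁺* h {x} p = go (ℕ.≤⇒≤′ p)
      where
      go : ∀ {y} → x ℕ.≤′ y → I x ≤ I y
      go ℕ.≤′-refl     = ≤-refl
      go (ℕ.≤′-step q) = ≤-trans (go q) (mono⁺ h _)

    X-2I : ℕ → ℤ
    X-2I c = X c - (I c + I c)

    -- Any window [c , c + n] with a ≤ c splits at a + n; the right-hand part is a translate of [a , c].
    split⁻ : ∀ {z a c} → a ℕ.≤ c → z ≤ I a → (∀ d → a ℕ.≤ d → d ℕ.≤ c → z ≤ X d + δ) → z ≤ I c
    split⁻ {z} {a} {c} a≤c z≤Ia h = I-greatest c low
      where
      low : ∀ e → c ℕ.≤ e → e ℕ.≤ c ℕ.+ n → z ≤ X e
      low e p q with ℕ.≤-total e (a ℕ.+ n)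
      ... | inj₁ r = ≤-trans z≤Ia (lower (I-isMin a) e (ℕ.≤-trans a≤c p) r)
      ... | inj₂ r =
        let eq = ℕ.m∸n+n≡m (ℕ.≤-trans (ℕ.m≤n+m n a) r) in
        subst (z ≤_) (trans (sym (per (e ℕ.∸ n))) (cong X eq))
          (h (e ℕ.∸ n) (ℕ.+-cancelʳ-≤ n _ _ (subst (a ℕ.+ n ℕ.≤_) (sym eq) r))
                       (ℕ.+-cancelʳ-≤ n _ _ (subst (ℕ._≤ c ℕ.+ n) (sym eq) q)))

    split⁺ : ∀ {z b c} → c ℕ.≤ b → z ≤ I b → (∀ d → c ℕ.≤ d → d ℕ.≤ b → z ≤ X d) → z ≤ I c
    split⁺ {z} {b} {c} c≤b z≤Ib h = I-greatest c low
      where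
      low : ∀ e → c ℕ.≤ e → e ℕ.≤ c ℕ.+ n → z ≤ X e
      low e p q with ℕ.≤-total e b
      ... | inj₁ r = h e p r
      ... | inj₂ r = ≤-trans z≤Ib (lower (I-isMin b) e r (ℕ.≤-trans q (ℕ.+-monoˡ-≤ n c≤b)))

    -- Where I does not vary, X - 2I is a translate of X.
    constant-case : ∀ {a b m} → a ℕ.≤ b → (∀ c → a ℕ.≤ c → c ℕ.≤ b → I c ≡ I a) →
                    IsMin X a b m → IsMin X-2I a b (m - (I a + I b))
    constant-case {a} {b} {m} a≤b const mn = isMin
      (λ c p q → subst₂ _≤_
         (cong (λ i → m - (I a + i)) (sym (const b a≤b ℕ.≤-refl)))
         (cong (λ i → X c - (i + i)) (sym (const c p q)))
         (+-monoˡ-≤ (- (I a + I a)) (lower mn c p q)))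
      (arg mn) (a≤arg mn) (arg≤b mn)
      (cong₂ (λ i j → i - j) (att mn)
        (cong₂ _+_ (const _ (a≤arg mn) (arg≤b mn))
                   (trans (const _ (a≤arg mn) (arg≤b mn)) (sym (const b a≤b ℕ.≤-refl)))))

    -- I is nonincreasing here. If `m + δ < I a`, the minimum of X on [a , b], moved on by a period,
    -- enters the window of b, so `I b` is `m + δ` and the claimed value is -I a - δ. It is a lower
    -- bound by `I c ≤ X c + δ` and `I c ≤ I a`. It is attained where X + δ first comes down to
    -- `I a`: up to there no smaller value has entered the window. Otherwise I is constant on
    -- [a , b].
    pitman⁻ : δ ≤ 0ℤ → ∀ {a b m} → a ℕ.≤ b → IsMin X a b m → IsMin X-2I a b (m - (I a + I b))
    pitman⁻ δ≤0 {a} {b} {m} a≤b mn with m + δ <? I a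
    ... | no m+δ≮Ia = constant-case a≤b
            (λ c p q → ≤-antisym (mono⁻* δ≤0 p)
              (split⁻ p ≤-refl λ d r s →
                ≤-trans (≮⇒≥ m+δ≮Ia) (+-monoˡ-≤ δ (lower mn d r (ℕ.≤-trans s q)))))
            mn
    ... | yes m+δ<Ia = isMin low c a≤c (ℕ.≤-trans c≤k argk≤b) attained
      where
      o = arg mn
      k = o ℕ.∸ a
      a+k≡o : a ℕ.+ k ≡ o
      a+k≡o = ℕ.m+[n∸m]≡n (a≤arg mn)
      argk≤b : a ℕ.+ k ℕ.≤ b
      argk≤b = subst (ℕ._≤ b) (sym a+k≡o) (arg≤b mn)
      Ib : I b ≡ m + δ
      Ib = ≤-antisym
        (≤-trans (mono⁻* δ≤0 (arg≤b mn)) (subst (λ i → I o ≤ i + δ) (att mn) (I≤X+δ o)))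
        (split⁻ a≤b (<⇒≤ m+δ<Ia) λ d r s → +-monoˡ-≤ δ (lower mn d r s))
      goal : m - (I a + I b) ≡ - I a - δ
      goal = trans (cong (λ i → m - (I a + i)) Ib)
        (solve 3 (λ m i d → m :- (i :+ (m :+ d)) := :- i :- d) refl m (I a) δ)
      low : ∀ c → a ℕ.≤ c → c ℕ.≤ b → m - (I a + I b) ≤ X-2I c
      low c p q = subst (_≤ X-2I c) (sym goal) (≤-by₂ (I≤X+δ c) (mono⁻* δ≤0 p)
        (solve 4 (λ x i j d → (x :- (j :+ j)) :- (:- i :- d) := ((x :+ d) :- j) :+ (i :- j)) refl
          (X c) (I a) (I c) δ))
      hit = first-hit (λ x → X x + δ) (I a)
        (λ x → ≤-by (down x) (solve 3 (λ x y d → ((y :+ d) :+ con 1ℤ) :- (x :+ d) := (y :+ con 1ℤ) :- x) refl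
                                (X x) (X (suc x)) δ))
        a k (I≤X+δ a)
        (subst (λ y → y + δ < I a) (sym (trans (cong X a+k≡o) (att mn))) m+δ<Ia)
      c = proj₁ hit
      a≤c = proj₁ (proj₂ hit)
      c≤k = proj₁ (proj₂ (proj₂ hit))
      Xc = proj₁ (proj₂ (proj₂ (proj₂ hit)))
      Ic : I c ≡ I a
      Ic = ≤-antisym (mono⁻* δ≤0 a≤c) (split⁻ a≤c ≤-refl (proj₂ (proj₂ (proj₂ (proj₂ hit)))))
      attained : X-2I c ≡ m - (I a + I b)
      attained = trans (cong (λ i → X c - (i + i)) Ic) (trans
        (≡-by Xc (solve 3 (λ x i d → (:- i :- d) :- (x :- (i :+ i)) := i :- (x :+ d)) refl (X c) (I a) δ))
        (sym goal))

    -- I is nondecreasing here. If `m < I b`, then `I a` is `m` and the claimed value is -I b. It is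
    -- a lower bound by `I c ≤ X c` and `I c ≤ I b`, and is attained where X is at `I b` for the
    -- last time: from there on X stays above that level, so I has already reached it.
    pitman⁺ : 0ℤ ≤ δ → ∀ {a b m} → a ℕ.≤ b → IsMin X a b m → IsMin X-2I a b (m - (I a + I b))
    pitman⁺ 0≤δ {a} {b} {m} a≤b mn with m <? I b
    ... | no m≮Ib = constant-case a≤b (λ c p q → trans (const c p q) (sym (const a ℕ.≤-refl a≤b))) mn
      where
      const : ∀ c → a ℕ.≤ c → c ℕ.≤ b → I c ≡ I b
      const c p q = ≤-antisym (mono⁺* 0≤δ q)
        (split⁺ q ≤-refl λ d r s → ≤-trans (≮⇒≥ m≮Ib) (lower mn d (ℕ.≤-trans p r) s))
    ... | yes m<Ib = isMin low c (ℕ.≤-trans (a≤arg mn) o≤c) c≤b attained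
      where
      o = arg mn
      k = b ℕ.∸ o
      o+k≡b : o ℕ.+ k ≡ b
      o+k≡b = ℕ.m+[n∸m]≡n (arg≤b mn)
      Ia : I a ≡ m
      Ia = ≤-antisym
        (≤-trans (mono⁺* 0≤δ (a≤arg mn)) (subst (I o ≤_) (att mn) (I≤X o)))
        (split⁺ a≤b (<⇒≤ m<Ib) (lower mn))
      goal : m - (I a + I b) ≡ - I b
      goal = trans (cong (λ i → m - (i + I b)) Ia)
        (solve 2 (λ m i → m :- (m :+ i) := :- i) refl m (I b))
      low : ∀ c → a ℕ.≤ c → c ℕ.≤ b → m - (I a + I b) ≤ X-2I c
      low c p q = subst (_≤ X-2I c) (sym goal) (≤-by₂ (I≤X c) (mono⁺* 0≤δ q)
        (solve 3 (λ x i j → (x :- (j :+ j)) :- (:- i) := (x :- j) :+ (i :- j)) refl (X c) (I b) (I c)))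
      hit = last-hit X (I b) up o k
        (subst (λ y → I b ≤ X y) (sym o+k≡b) (I≤X b))
        (subst (_< I b) (sym (att mn)) m<Ib)
      c = proj₁ hit
      o≤c = proj₁ (proj₂ hit)
      c≤b : c ℕ.≤ b
      c≤b = subst (c ℕ.≤_) o+k≡b (proj₁ (proj₂ (proj₂ hit)))
      Xc = proj₁ (proj₂ (proj₂ (proj₂ hit)))
      Ic : I c ≡ I b
      Ic = ≤-antisym (mono⁺* 0≤δ c≤b)
        (split⁺ c≤b ≤-refl λ d r s →
          proj₂ (proj₂ (proj₂ (proj₂ hit))) d r (subst (d ℕ.≤_) (sym o+k≡b) s))
      attained : X-2I c ≡ m - (I a + I b)
      attained = trans (cong₂ (λ x i → x - (i + i)) Xc Ic) (trans
        (solve 1 (λ i → i :- (i :+ i) := :- i) refl (I b)) (sym goal))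

    pitman : ∀ {a b m} → a ℕ.≤ b → IsMin X a b m → IsMin X-2I a b (m - (I a + I b))
    pitman with ≤-total δ 0ℤ
    ... | inj₁ h = pitman⁻ h
    ... | inj₂ h = pitman⁺ h

    -- The conditions on X say that I moves only together with X and in the same direction. This is
    -- what will keep the modified indicator functions inside {0, 1}.
    data Jump (x : ℕ) : Set where
      stay : I (suc x) ≡ I x → Jump x
      fall : I (suc x) ≡ I x - 1ℤ → X (suc x) ≤ X x - 1ℤ → Jump x
      rise : I (suc x) ≡ I x + 1ℤ → X x + 1ℤ ≤ X (suc x) → Jump x

    -- Moving the window adds one point on the right. If I changes, the new minimum sits there, so
    -- `I (suc x)` equals `X (suc x) + δ`, to be compared with `I x ≤ X x + δ`.
    jump⁻ : δ ≤ 0ℤ → ∀ x → Jump x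
    jump⁻ δ≤0 x with I-isMin (suc x) | I (suc x) ≟ᶻ I x
    ... | mn | yes e = stay e
    ... | mn | no ne with ℕ.m≤n⇒m<n∨m≡n (arg≤b mn)
    ...   | inj₁ arg< = contradiction
      (≤-antisym (mono⁻ δ≤0 x)
        (subst (I x ≤_) (att mn) (lower (I-isMin x) (arg mn) (ℕ.<⇒≤ (a≤arg mn)) (ℕ.≤-pred arg<)))) ne
    ...   | inj₂ arg≡ = fall
      (≤-antisym
        (≤-by (<⇒+1≤ (≤∧≢⇒< (mono⁻ δ≤0 x) ne))
          (solve 2 (λ i j → (i :- con 1ℤ) :- j := i :- (j :+ con 1ℤ)) refl (I x) (I (suc x))))
        (subst (I x - 1ℤ ≤_) (sym J≡) (≤-by₂ (I≤X+δ x) (down x)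
          (solve 4 (λ i y z d → (z :+ d) :- (i :- con 1ℤ) := ((y :+ d) :- i) :+ ((z :+ con 1ℤ) :- y)) refl
            (I x) (X x) (X (suc x)) δ))))
      (≤-by₂ (I≤X+δ x) (subst (λ j → j + 1ℤ ≤ I x) J≡ (<⇒+1≤ (≤∧≢⇒< (mono⁻ δ≤0 x) ne)))
        (solve 4 (λ i y z d → (y :- con 1ℤ) :- z := ((y :+ d) :- i) :+ (i :- ((z :+ d) :+ con 1ℤ))) refl
            (I x) (X x) (X (suc x)) δ))
      where
      J≡ : I (suc x) ≡ X (suc x) + δ
      J≡ = trans (sym (att mn)) (trans (cong X arg≡) (per (suc x)))

    -- Dually, moving the window drops its left point. If I changes, the old minimum sat there, so
    -- `I x` equals `X x`.
    jump⁺ : 0ℤ ≤ δ → ∀ x → Jump x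
    jump⁺ 0≤δ x with I-isMin x | I x ≟ᶻ I (suc x)
    ... | mn | yes e = stay (sym e)
    ... | mn | no ne with ℕ.m≤n⇒m<n∨m≡n (a≤arg mn)
    ...   | inj₁ <arg = contradiction
      (≤-antisym (mono⁺ 0≤δ x)
        (subst (I (suc x) ≤_) (att mn) (lower (I-isMin (suc x)) (arg mn) <arg (ℕ.m≤n⇒m≤1+n (arg≤b mn))))) ne
    ...   | inj₂ ≡arg = rise
      (≤-antisym
        (subst (λ j → I (suc x) ≤ j + 1ℤ) (sym I≡) (≤-trans (I≤X (suc x)) (up x)))
        (<⇒+1≤ (≤∧≢⇒< (mono⁺ 0≤δ x) ne)))
      (≤-trans (subst (λ j → j + 1ℤ ≤ I (suc x)) I≡ (<⇒+1≤ (≤∧≢⇒< (mono⁺ 0≤δ x) ne))) (I≤X (suc x)))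
      where
      I≡ : I x ≡ X x
      I≡ = trans (sym (att mn)) (cong X (sym ≡arg))

    jump : ∀ x → Jump x
    jump with ≤-total δ 0ℤ
    ... | inj₁ h = jump⁻ h
    ... | inj₂ h = jump⁺ h

-- Queues as periodic 0/1 functions: the action on sets and the exchange involution.

module QueueAction where

  open import Data.Integer using (+_; 0ℤ; 1ℤ; -1ℤ; _+_; _-_; -_; _≤_; +≤+)
  open import Data.Integer.Properties renaming (_≟_ to _≟ᶻ_)
  open import Data.Integer.Solver using (module +-*-Solver)
  open +-*-Solver
  open WindowMinimum
  open IsMin

  psum : (ℕ → ℤ) → ℕ → ℤ
  psum f zero    = 0ℤ
  psum f (suc x) = psum f x + f x

  psum-cong : ∀ {f g} → (∀ x → f x ≡ g x) → ∀ x → psum f x ≡ psum g x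
  psum-cong h zero    = refl
  psum-cong h (suc x) = cong₂ _+_ (psum-cong h x) (h x)

  psum-+ : ∀ f g x → psum (λ y → f y + g y) x ≡ psum f x + psum g x
  psum-+ f g zero    = refl
  psum-+ f g (suc x) = trans (cong (_+ (f x + g x)) (psum-+ f g x))
    (solve 4 (λ a b c d → (a :+ b) :+ (c :+ d) := (a :+ c) :+ (b :+ d)) refl (psum f x) (psum g x) (f x) (g x))

  psum-minus : ∀ f g x → psum (λ y → f y - g y) x ≡ psum f x - psum g x
  psum-minus f g zero    = refl
  psum-minus f g (suc x) = trans (cong (_+ (f x - g x)) (psum-minus f g x))
    (solve 4 (λ a b c d → (a :- b) :+ (c :- d) := (a :+ c) :- (b :+ d)) refl (psum f x) (psum g x) (f x) (g x))

  psum-telescope : ∀ (F : ℕ → ℤ) x → psum (λ y → F (suc y) - F y) x ≡ F x - F 0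
  psum-telescope F zero    = sym (+-inverseʳ (F 0))
  psum-telescope F (suc x) = trans (cong (_+ (F (suc x) - F x)) (psum-telescope F x))
    (solve 3 (λ a b c → (b :- a) :+ (c :- b) := c :- a) refl (F 0) (F x) (F (suc x)))

  psum-periodic : ∀ {f n} → (∀ x → f (x ℕ.+ n) ≡ f x) → ∀ x → psum f (x ℕ.+ n) ≡ psum f x + psum f n
  psum-periodic {f} {n} per zero    = sym (+-identityˡ _)
  psum-periodic {f} {n} per (suc x) = trans (cong₂ _+_ (psum-periodic per x) (per x))
    (solve 3 (λ a b c → (a :+ b) :+ c := (a :+ c) :+ b) refl (psum f x) (psum f n) (f x))

  psum-shift : ∀ f x → psum f (suc x) ≡ f 0 + psum (f ∘ suc) x
  psum-shift f zero    = +-comm 0ℤ (f 0)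
  psum-shift f (suc x) = trans (cong (_+ f (suc x)) (psum-shift f x)) (+-assoc (f 0) _ _)

  bit : Bool → ℤ
  bit true  = 1ℤ
  bit false = 0ℤ

  bit-injective : ∀ {b c} → bit b ≡ bit c → b ≡ c
  bit-injective {true}  {true}  _ = refl
  bit-injective {false} {false} _ = refl

  bit≥0 : ∀ b → 0ℤ ≤ bit b
  bit≥0 true  = +≤+ ℕ.z≤n
  bit≥0 false = +≤+ ℕ.z≤n

  bit≤1 : ∀ b → bit b ≤ 1ℤ
  bit≤1 true  = +≤+ (ℕ.s≤s ℕ.z≤n)
  bit≤1 false = +≤+ ℕ.z≤n

  isOne : ℤ → Bool
  isOne z = does (z ≟ᶻ 1ℤ)

  bit-isOne : ∀ {z} → z ≡ 0ℤ ⊎ z ≡ 1ℤ → bit (isOne z) ≡ z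
  bit-isOne (inj₁ refl) = refl
  bit-isOne (inj₂ refl) = refl

  psum-bits : ∀ {m} (q : Vec Bool m) f → (∀ i → f (toℕ i) ≡ bit (lookup q i)) → psum f m ≡ + ∣ q ∣
  psum-bits []          f h = refl
  psum-bits {suc m} (true  ∷ q) f h = trans (psum-shift f m) (cong₂ _+_ (h Fin.zero) (psum-bits q (f ∘ suc) (h ∘ Fin.suc)))
  psum-bits {suc m} (false ∷ q) f h = trans (psum-shift f m) (trans (cong₂ _+_ (h Fin.zero) (psum-bits q (f ∘ suc) (h ∘ Fin.suc)))
    (+-identityˡ _))

  lookup-ext : ∀ {a} {A : Set a} {m} {p q : Vec A m} → (∀ i → lookup p i ≡ lookup q i) → p ≡ q
  lookup-ext {p = p} {q} h = trans (sym (tabulate∘lookup p)) (trans (tabulate-cong h) (tabulate∘lookup q))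

  module Queues (n : ℕ) .{{_ : NonZero n}} where

    site-periodic : ∀ x → site n (x ℕ.+ n) ≡ site n x
    site-periodic x = toℕ-injective (trans (toℕ-fromℕ< _) (trans ([m+n]%n≡m%n x n) (sym (toℕ-fromℕ< _))))

    site-toℕ : ∀ i → site n (toℕ i) ≡ i
    site-toℕ i = toℕ-injective (trans (toℕ-fromℕ< _) (m<n⇒m%n≡m (toℕ<n i)))

    at-site : ∀ {A : Set} (F : ℕ → A) → (∀ x → F (x ℕ.+ n) ≡ F x) → ∀ x → F (toℕ (site n x)) ≡ F x
    at-site F per x = trans (cong F (toℕ-fromℕ< (m%n<n x n)))
      (sym (trans (cong F (m≡m%n+[m/n]*n x n)) (multiple (x / n) (x % n))))
      where
      multiple : ∀ k y → F (y ℕ.+ k ℕ.* n) ≡ F y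
      multiple zero    y = cong F (ℕ.+-identityʳ y)
      multiple (suc k) y = trans (cong F (sym (ℕ.+-assoc y n (k ℕ.* n)))) (trans (multiple k (y ℕ.+ n)) (per y))

    -- The circle is unrolled onto ℕ, so that cyclic windows become ordinary intervals and partial
    -- sums become walks.
    hat : Subset n → ℕ → ℤ
    hat q x = bit (lookup q (site n x))

    hat-periodic : ∀ q x → hat q (x ℕ.+ n) ≡ hat q x
    hat-periodic q x = cong (bit ∘ lookup q) (site-periodic x)

    hat-injective : ∀ {p q} → (∀ x → hat p x ≡ hat q x) → p ≡ q
    hat-injective {p} {q} h = lookup-ext λ i →
      subst (λ j → lookup p j ≡ lookup q j) (site-toℕ i) (bit-injective (h (toℕ i)))

    psum-hat : ∀ q → psum (hat q) n ≡ + ∣ q ∣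
    psum-hat q = psum-bits q (hat q) λ i → cong (bit ∘ lookup q) (site-toℕ i)

    card-cong : ∀ p q → psum (hat p) n ≡ psum (hat q) n → ∣ p ∣ ≡ ∣ q ∣
    card-cong p q e = +-injective (trans (sym (psum-hat p)) (trans e (psum-hat q)))

    step : Subset n → Subset n → ℕ → ℤ
    step B q x = hat B x - hat q x

    walk : Subset n → Subset n → ℕ → ℤ
    walk B q = psum (step B q)

    walk-periodic : ∀ B q x → walk B q (x ℕ.+ n) ≡ walk B q x + walk B q n
    walk-periodic B q = psum-periodic (λ x → cong₂ _-_ (hat-periodic B x) (hat-periodic q x))

    walk-down : ∀ B q x → walk B q x ≤ walk B q (suc x) + 1ℤ
    walk-down B q x = ≤-by₂ (bit≥0 (lookup B (site n x))) (bit≤1 (lookup q (site n x)))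
      (solve 3 (λ w b c → ((w :+ (b :- c)) :+ con 1ℤ) :- w := (b :- con 0ℤ) :+ (con 1ℤ :- c)) refl
        (walk B q x) (hat B x) (hat q x))

    walk-up : ∀ B q x → walk B q (suc x) ≤ walk B q x + 1ℤ
    walk-up B q x = ≤-by₂ (bit≥0 (lookup q (site n x))) (bit≤1 (lookup B (site n x)))
      (solve 3 (λ w b c → (w :+ con 1ℤ) :- (w :+ (b :- c)) := (c :- con 0ℤ) :+ (con 1ℤ :- b)) refl
        (walk B q x) (hat B x) (hat q x))

    module W (B q : Subset n) = Pitman n (walk B q) (walk B q n) (walk-periodic B q) (walk-down B q) (walk-up B q)

    I : Subset n → Subset n → ℕ → ℤ
    I B q = W.I B q

    Δ : Subset n → Subset n → ℕ → ℤ
    Δ B q x = I B q (suc x) - I B q x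

    Δ-periodic : ∀ B q x → Δ B q (x ℕ.+ n) ≡ Δ B q x
    Δ-periodic B q x = trans (cong₂ _-_ (W.I-periodic B q (suc x)) (W.I-periodic B q x))
      (solve 3 (λ a b d → (a :+ d) :- (b :+ d) := a :- b) refl (I B q (suc x)) (I B q x) (walk B q n))

    psum-Δ : ∀ B q → psum (Δ B q) n ≡ walk B q n
    psum-Δ B q = trans (psum-telescope (I B q) n) (trans (cong (_- I B q 0) (W.I-periodic B q 0))
      (solve 2 (λ i d → (i :+ d) :- i := d) refl (I B q 0) (walk B q n)))

    -- Indexed by the increment d of I. The constraints on the bits b and c are exactly what makes
    -- both `c + d` and `b - d` bits again, as `act` and `swap₁` require.
    data Change (b c : ℤ) : ℤ → Set where
      none : Change b c 0ℤ
      loss : b ≡ 0ℤ → c ≡ 1ℤ → Change b c -1ℤ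
      gain : b ≡ 1ℤ → c ≡ 0ℤ → Change b c 1ℤ

    lossy : ∀ b c → bit b - bit c ≤ -1ℤ → Change (bit b) (bit c) -1ℤ
    lossy false true  _ = loss refl refl
    lossy true  true  ()
    lossy true  false ()
    lossy false false ()

    gainy : ∀ b c → 1ℤ ≤ bit b - bit c → Change (bit b) (bit c) 1ℤ
    gainy true  false _ = gain refl refl
    gainy true  true  (+≤+ ())
    gainy false true  ()
    gainy false false (+≤+ ())

    change : ∀ B q x → Change (hat B x) (hat q x) (Δ B q x)
    change B q x = go (W.jump B q x)
      where
      b c : Bool
      b = lookup B (site n x)
      c = lookup q (site n x)
      i-1-i : ∀ i → (i - 1ℤ) - i ≡ -1ℤ
      i-1-i = solve 1 (λ i → (i :- con 1ℤ) :- i := con -1ℤ) refl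
      i+1-i : ∀ i → (i + 1ℤ) - i ≡ 1ℤ
      i+1-i = solve 1 (λ i → (i :+ con 1ℤ) :- i := con 1ℤ) refl
      fall-eq : ∀ w s → -1ℤ - s ≡ (w - 1ℤ) - (w + s)
      fall-eq = solve 2 (λ w s → con -1ℤ :- s := (w :- con 1ℤ) :- (w :+ s)) refl
      rise-eq : ∀ w s → s - 1ℤ ≡ (w + s) - (w + 1ℤ)
      rise-eq = solve 2 (λ w s → s :- con 1ℤ := (w :+ s) :- (w :+ con 1ℤ)) refl
      go : W.Jump B q x → Change (bit b) (bit c) (Δ B q x)
      go (W.stay e) = subst (Change (bit b) (bit c)) (sym (i≡j⇒i-j≡0 e)) none
      go (W.fall e h) = subst (Change (bit b) (bit c)) (sym (trans (cong (_- I B q x) e) (i-1-i (I B q x))))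
        (lossy b c (≤-by h (fall-eq (walk B q x) (step B q x))))
      go (W.rise e h) = subst (Change (bit b) (bit c)) (sym (trans (cong (_- I B q x) e) (i+1-i (I B q x))))
        (gainy b c (≤-by h (rise-eq (walk B q x) (step B q x))))

    bit-cases : ∀ b → bit b ≡ 0ℤ ⊎ bit b ≡ 1ℤ
    bit-cases true  = inj₂ refl
    bit-cases false = inj₁ refl

    Change-+ : ∀ {b c d} → c ≡ 0ℤ ⊎ c ≡ 1ℤ → Change b c d → c + d ≡ 0ℤ ⊎ c + d ≡ 1ℤ
    Change-+ (inj₁ refl) none  = inj₁ refl
    Change-+ (inj₂ refl) none  = inj₂ refl
    Change-+ _ (loss _ refl)   = inj₁ refl
    Change-+ _ (gain _ refl)   = inj₂ refl

    Change-− : ∀ {b c d} → b ≡ 0ℤ ⊎ b ≡ 1ℤ → Change b c d → b - d ≡ 0ℤ ⊎ b - d ≡ 1ℤ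
    Change-− (inj₁ refl) none  = inj₁ refl
    Change-− (inj₂ refl) none  = inj₂ refl
    Change-− _ (loss refl _)   = inj₂ refl
    Change-− _ (gain refl _)   = inj₁ refl

    fromHat : (ℕ → ℤ) → Subset n
    fromHat F = tabulate (λ i → isOne (F (toℕ i)))

    hat-fromHat : ∀ F → (∀ x → F (x ℕ.+ n) ≡ F x) → (∀ x → F x ≡ 0ℤ ⊎ F x ≡ 1ℤ) → ∀ x → hat (fromHat F) x ≡ F x
    hat-fromHat F per bits x = trans (cong bit (lookup∘tabulate (λ i → isOne (F (toℕ i))) (site n x)))
      (trans (bit-isOne (bits (toℕ (site n x)))) (at-site F per x))

    act : Subset n → Subset n → Subset n
    act q B = fromHat (λ x → hat q x + Δ B q x)

    hat-act : ∀ q B x → hat (act q B) x ≡ hat q x + Δ B q x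
    hat-act q B = hat-fromHat _ (λ x → cong₂ _+_ (hat-periodic q x) (Δ-periodic B q x)) bits
      where
      bits : ∀ x → hat q x + Δ B q x ≡ 0ℤ ⊎ hat q x + Δ B q x ≡ 1ℤ
      bits x = Change-+ (bit-cases (lookup q (site n x))) (change B q x)

    swap₁ swap₂ : Subset n → Subset n → Subset n
    swap₁ p q = fromHat (λ x → hat p x - Δ p q x)
    swap₂ p q = act q p

    hat-swap₁ : ∀ p q x → hat (swap₁ p q) x ≡ hat p x - Δ p q x
    hat-swap₁ p q = hat-fromHat _ (λ x → cong₂ _-_ (hat-periodic p x) (Δ-periodic p q x)) bits
      where
      bits : ∀ x → hat p x - Δ p q x ≡ 0ℤ ⊎ hat p x - Δ p q x ≡ 1ℤ
      bits x = Change-− (bit-cases (lookup p (site n x))) (change p q x)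

    hat-swap-sum : ∀ p q x → hat (swap₁ p q) x + hat (swap₂ p q) x ≡ hat p x + hat q x
    hat-swap-sum p q x = trans (cong₂ _+_ (hat-swap₁ p q x) (hat-act q p x))
      (solve 3 (λ a b d → (a :- d) :+ (b :+ d) := a :+ b) refl (hat p x) (hat q x) (Δ p q x))

    psum-act : ∀ q B x → psum (hat (act q B)) x ≡ psum (hat q) x + (I B q x - I B q 0)
    psum-act q B x = trans (psum-cong (hat-act q B) x) (trans (psum-+ (hat q) (Δ B q) x)
      (cong (_+_ (psum (hat q) x)) (psum-telescope (I B q) x)))

    psum-swap₁ : ∀ p q x → psum (hat (swap₁ p q)) x ≡ psum (hat p) x - (I p q x - I p q 0)
    psum-swap₁ p q x = trans (psum-cong (hat-swap₁ p q) x) (trans (psum-minus (hat p) (Δ p q) x)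
      (cong (_-_ (psum (hat p) x)) (psum-telescope (I p q) x)))

    walk≡ : ∀ B q x → walk B q x ≡ psum (hat B) x - psum (hat q) x
    walk≡ B q = psum-minus (hat B) (hat q)

    I-increment : ∀ B q → I B q n - I B q 0 ≡ psum (hat B) n - psum (hat q) n
    I-increment B q = trans (sym (psum-telescope (I B q) n)) (trans (psum-Δ B q) (walk≡ B q n))

    -- Over one period I gains the drift of the walk, which is the size of B minus that of q.
    ∣act∣ : ∀ q B → ∣ act q B ∣ ≡ ∣ B ∣
    ∣act∣ q B = card-cong (act q B) B (trans (psum-act q B n) (trans (cong (_+_ (psum (hat q) n)) (I-increment B q))
      (solve 2 (λ b c → c :+ (b :- c) := b) refl (psum (hat B) n) (psum (hat q) n))))

    ∣swap₁∣ : ∀ p q → ∣ swap₁ p q ∣ ≡ ∣ q ∣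
    ∣swap₁∣ p q = card-cong (swap₁ p q) q (trans (psum-swap₁ p q n) (trans (cong (λ d → psum (hat p) n - d) (I-increment p q))
      (solve 2 (λ b c → b :- (b :- c) := c) refl (psum (hat p) n) (psum (hat q) n))))

    ∣swap₂∣ : ∀ p q → ∣ swap₂ p q ∣ ≡ ∣ p ∣
    ∣swap₂∣ p q = ∣act∣ q p

    -- Without drift I is both nonincreasing and nondecreasing. This settles the saturated flows,
    -- whose queue lengths the walk does not determine.
    act-same-size : ∀ q B → ∣ B ∣ ≡ ∣ q ∣ → act q B ≡ q
    act-same-size q B e = hat-injective λ x → trans (hat-act q B x)
      (trans (cong (_+_ (hat q x)) (i≡j⇒i-j≡0 (≤-antisym (W.mono⁻ B q (≤-reflexive δ≡0) x) (W.mono⁺ B q (≤-reflexive (sym δ≡0)) x))))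
             (+-identityʳ _))
      where
      δ≡0 : walk B q n ≡ 0ℤ
      δ≡0 = trans (walk≡ B q n) (i≡j⇒i-j≡0 (trans (psum-hat B) (trans (cong +_ e) (sym (psum-hat q)))))

    walk-swap : ∀ p q x → walk (swap₁ p q) (swap₂ p q) x ≡ W.X-2I p q x + (I p q 0 + I p q 0)
    walk-swap p q x = trans (walk≡ (swap₁ p q) (swap₂ p q) x)
      (trans (cong₂ _-_ (psum-swap₁ p q x) (psum-act q p x))
      (trans (solve 4 (λ a b i o → (a :- (i :- o)) :- (b :+ (i :- o)) := ((a :- b) :- (i :+ i)) :+ (o :+ o)) refl
               (psum (hat p) x) (psum (hat q) x) (I p q x) (I p q 0))
             (cong (λ w → (w - (I p q x + I p q x)) + (I p q 0 + I p q 0)) (sym (walk≡ p q x)))))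

    -- The identity is applied to the window [x , x + n] itself, where the minimum of X is
    -- `I p q x`; subtracting `I p q x` and `I p q (x + n)` leaves minus the latter. So the exchange
    -- reverses the increments of I, which makes it an involution.
    I-swap : ∀ p q x → I (swap₁ p q) (swap₂ p q) x ≡ (I p q 0 + I p q 0) - (I p q x + walk p q n)
    I-swap p q x = IsMin-unique (W.I-isMin (swap₁ p q) (swap₂ p q) x) (isMin
        (λ c r s → subst (_ ≤_) (sym (walk-swap p q c)) (≤-by (lower m c r s) (eq (W.X-2I p q c))))
        (arg m) (a≤arg m) (arg≤b m)
        (trans (walk-swap p q (arg m)) (sym (≡-by (sym (att m)) (eq (W.X-2I p q (arg m)))))))
      where
      m = W.pitman p q (ℕ.m≤m+n x n) (W.I-isMin p q x)
      eq : ∀ z → (z + (I p q 0 + I p q 0)) - ((I p q 0 + I p q 0) - (I p q x + walk p q n))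
               ≡ z - (I p q x - (I p q x + I p q (x ℕ.+ n)))
      eq z = trans (solve 4 (λ z o i d → (z :+ (o :+ o)) :- ((o :+ o) :- (i :+ d)) := z :- (i :- (i :+ (i :+ d)))) refl
                      z (I p q 0) (I p q x) (walk p q n))
                   (cong (λ j → z - (I p q x - (I p q x + j))) (sym (W.I-periodic p q x)))

    Δ-swap : ∀ p q x → Δ (swap₁ p q) (swap₂ p q) x ≡ - Δ p q x
    Δ-swap p q x = trans (cong₂ _-_ (I-swap p q (suc x)) (I-swap p q x))
      (solve 4 (λ o i j d → (o :- (i :+ d)) :- (o :- (j :+ d)) := :- (i :- j)) refl
        (I p q 0 + I p q 0) (I p q (suc x)) (I p q x) (walk p q n))

    swap₁-involutive : ∀ p q → swap₁ (swap₁ p q) (swap₂ p q) ≡ p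
    swap₁-involutive p q = hat-injective λ x → trans (hat-swap₁ (swap₁ p q) (swap₂ p q) x)
      (trans (cong₂ _-_ (hat-swap₁ p q x) (Δ-swap p q x))
        (solve 2 (λ a d → (a :- d) :- (:- d) := a) refl (hat p x) (Δ p q x)))

    swap₂-involutive : ∀ p q → swap₂ (swap₁ p q) (swap₂ p q) ≡ q
    swap₂-involutive p q = hat-injective λ x → trans (hat-act (swap₂ p q) (swap₁ p q) x)
      (trans (cong₂ _+_ (hat-act q p x) (Δ-swap p q x))
        (solve 2 (λ a d → (a :+ d) :+ (:- d) := a) refl (hat q x) (Δ p q x)))

    record InWindow (x c e : ℕ) : Set where
      constructor window
      field
        x≤c : x ℕ.≤ c
        c≤  : c ℕ.≤ x ℕ.+ n
        c≤e : c ℕ.≤ e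
        e≤  : e ℕ.≤ c ℕ.+ n

    -- Two queues in tandem and last passage.

    module Tandem (B p q : Subset n) where

      Z : ℕ → ℕ → ℤ
      Z c e = (psum (hat B) e - psum (hat p) e) + (psum (hat p) c - psum (hat q) c)

      -- The walk of the second queue at c contains `I B p c`, itself a minimum over e. The nested
      -- minima merge into one minimum of `Z` over the pairs `InWindow x`; adding `I B p 0` removes
      -- the constant left by summing increments from 0.
      M : ℕ → ℤ
      M x = I (act p B) q x + I B p 0

      walk₂ : ∀ c → walk (act p B) q c ≡ (psum (hat p) c - psum (hat q) c) + (I B p c - I B p 0)
      walk₂ c = trans (walk≡ (act p B) q c) (trans (cong (_- psum (hat q) c) (psum-act p B c))
        (solve 3 (λ a b d → (a :+ d) :- b := (a :- b) :+ d) refl (psum (hat p) c) (psum (hat q) c) (I B p c - I B p 0)))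

      M≤Z : ∀ {x c e} → InWindow x c e → M x ≤ Z c e
      M≤Z {x} {c} {e} (window a b r s) = ≤-by₂
        (subst (I (act p B) q x ≤_) (walk₂ c) (lower (W.I-isMin (act p B) q x) c a b))
        (subst (I B p c ≤_) (walk≡ B p e) (lower (W.I-isMin B p c) e r s))
        (solve 5 (λ w z i o m → (w :+ z) :- (m :+ o) := ((z :+ (i :- o)) :- m) :+ (w :- i)) refl
          (psum (hat B) e - psum (hat p) e) (psum (hat p) c - psum (hat q) c) (I B p c) (I B p 0) (I (act p B) q x))

      Z-attains : ∀ x → ∃ λ c → ∃ λ e → InWindow x c e × Z c e ≡ M x
      Z-attains x = c , e , window (a≤arg m) (arg≤b m) (a≤arg m′) (arg≤b m′) , eq
        where
        m = W.I-isMin (act p B) q x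
        c = arg m
        m′ = W.I-isMin B p c
        e = arg m′
        eq : Z c e ≡ M x
        eq = trans (cong (_+ (psum (hat p) c - psum (hat q) c)) (trans (sym (walk≡ B p e)) (att m′)))
          (trans (solve 3 (λ i z o → i :+ z := (z :+ (i :- o)) :+ o) refl (I B p c) (psum (hat p) c - psum (hat q) c) (I B p 0))
            (cong (_+ I B p 0) (trans (sym (walk₂ c)) (att m))))

    module _ (p q : Subset n) where

      private
        J : ℕ → ℤ
        J = I p q

      record Range (x c e : ℕ) : Set where
        field
          lo hi : ℕ
          lo≤c  : lo ℕ.≤ c
          c≤hi  : c ℕ.≤ hi
          ends  : J lo + J hi ≡ J x + J e
          fits  : ∀ c′ → lo ℕ.≤ c′ → c′ ℕ.≤ hi → InWindow x c′ e

      -- For fixed x and e the admissible c form an interval, whose ends agree with x and e up to a period.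
      range : ∀ {x c e} → InWindow x c e → Range x c e
      range {x} {c} {e} (window a b r s) with ℕ.≤-total e (x ℕ.+ n)
      ... | inj₁ h = record
        { lo = x ; hi = e ; lo≤c = a ; c≤hi = r ; ends = refl
        ; fits = λ c′ u v → window u (ℕ.≤-trans v h) v (ℕ.≤-trans h (ℕ.+-monoˡ-≤ n u)) }
      ... | inj₂ h = record
        { lo = e ℕ.∸ n ; hi = x ℕ.+ n
        ; lo≤c = ℕ.+-cancelʳ-≤ n _ _ (subst (ℕ._≤ c ℕ.+ n) (sym e′) s)
        ; c≤hi = b
        -- One end is e moved back by a period, the other x moved forward by one, so the two drifts
        -- cancel.
        ; ends = trans (cong (_+_ (J (e ℕ.∸ n))) (W.I-periodic p q x))
            (trans (solve 3 (λ i j d → i :+ (j :+ d) := j :+ (i :+ d)) refl (J (e ℕ.∸ n)) (J x) (walk p q n))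
              (cong (_+_ (J x)) (trans (sym (W.I-periodic p q (e ℕ.∸ n))) (cong J e′))))
        ; fits = λ c′ u v → window
            (ℕ.≤-trans (ℕ.+-cancelʳ-≤ n _ _ (subst (x ℕ.+ n ℕ.≤_) (sym e′) h)) u) v (ℕ.≤-trans v h)
            (subst (ℕ._≤ c′ ℕ.+ n) e′ (ℕ.+-monoˡ-≤ n u)) }
        where
        e′ : e ℕ.∸ n ℕ.+ n ≡ e
        e′ = ℕ.m∸n+n≡m (ℕ.≤-trans (ℕ.m≤n+m n x) h)

      module _ (B : Subset n) where

        private
          p′ = swap₁ p q
          q′ = swap₂ p q
          module T  = Tandem B p q
          module T′ = Tandem B p′ q′

        -- `J e` arises from replacing p by p′ in B - p. `J x` is supplied by hand to complete the
        -- sum `J x + J e`, which by `ends` is the correction of the Pitman identity on the range of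
        -- c.
        Z-swap : ∀ {x} c e → T′.Z c e + J x ≡
                 (psum (hat B) e - psum (hat p) e) + (W.X-2I p q c + (J x + J e)) + J 0
        Z-swap {x} c e = trans (cong (_+ J x)
          (cong₂ _+_ (cong (λ z → psum (hat B) e - z) (psum-swap₁ p q e))
                     (trans (sym (walk≡ p′ q′ c)) (walk-swap p q c))))
          (solve 6 (λ b a i j o z → ((b :- (a :- (i :- o))) :+ (z :+ (o :+ o))) :+ j
                                 := ((b :- a) :+ (z :+ (j :+ i))) :+ o) refl
            (psum (hat B) e) (psum (hat p) e) (J e) (J x) (J 0) (W.X-2I p q c))

        -- Each inequality starts from an optimal pair (c , e) of one side, keeps e, and replaces c
        -- by a minimiser for the other side on the interval of admissible points. On that interval
        -- minimising X - 2I and minimising X differ by `J lo + J hi` only.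
        M-swap : ∀ x → T′.M x + J x ≡ T.M x + J 0
        M-swap x = ≤-antisym
          (let c , e , w , eq = T.Z-attains x in le c e w eq)
          (let c , e , w , eq = T′.Z-attains x in ge c e w eq)
          where
          open ≤-Reasoning
          restore : ∀ v t → (v - t) + t ≡ v
          restore = solve 2 (λ v t → (v :- t) :+ t := v) refl
          le : ∀ c e → InWindow x c e → T.Z c e ≡ T.M x → T′.M x + J x ≤ T.M x + J 0
          le c e w eq = begin
              T′.M x + J x                                      ≤⟨ +-monoˡ-≤ (J x) (T′.M≤Z (fits (arg m) (a≤arg m) (arg≤b m))) ⟩
              T′.Z (arg m) e + J x                              ≡⟨ Z-swap (arg m) e ⟩
              s + (W.X-2I p q (arg m) + (J x + J e)) + J 0      ≡⟨ cong₂ (λ v t → s + (v + t) + J 0) (att m) (sym ends) ⟩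
              s + (proj₁ mX - (J lo + J hi) + (J lo + J hi)) + J 0 ≡⟨ cong (λ v → s + v + J 0) (restore (proj₁ mX) (J lo + J hi)) ⟩
              s + proj₁ mX + J 0                                ≤⟨ +-monoˡ-≤ (J 0) (+-monoʳ-≤ s (lower (proj₂ mX) c lo≤c c≤hi)) ⟩
              s + walk p q c + J 0                              ≡⟨ cong (λ v → s + v + J 0) (walk≡ p q c) ⟩
              T.Z c e + J 0                                     ≡⟨ cong (_+ J 0) eq ⟩
              T.M x + J 0                                       ∎
            where
            open Range (range w)
            mX = exists-min (walk p q) (ℕ.≤-trans lo≤c c≤hi)
            m = W.pitman p q (ℕ.≤-trans lo≤c c≤hi) (proj₂ mX)
            s = psum (hat B) e - psum (hat p) e
          ge : ∀ c e → InWindow x c e → T′.Z c e ≡ T′.M x → T.M x + J 0 ≤ T′.M x + J x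
          ge c e w eq = begin
              T.M x + J 0                                       ≤⟨ +-monoˡ-≤ (J 0) (T.M≤Z (fits o (a≤arg (proj₂ mX)) (arg≤b (proj₂ mX)))) ⟩
              T.Z o e + J 0                                     ≡⟨ cong (λ v → s + v + J 0) (sym (walk≡ p q o)) ⟩
              s + walk p q o + J 0                              ≡⟨ cong (λ v → s + v + J 0) (att (proj₂ mX)) ⟩
              s + proj₁ mX + J 0                                ≡⟨ cong (λ v → s + v + J 0) (sym (restore (proj₁ mX) (J lo + J hi))) ⟩
              s + (proj₁ mX - (J lo + J hi) + (J lo + J hi)) + J 0 ≤⟨ +-monoˡ-≤ (J 0) (+-monoʳ-≤ s (+-monoˡ-≤ (J lo + J hi) (lower m c lo≤c c≤hi))) ⟩
              s + (W.X-2I p q c + (J lo + J hi)) + J 0          ≡⟨ cong (λ t → s + (W.X-2I p q c + t) + J 0) ends ⟩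
              s + (W.X-2I p q c + (J x + J e)) + J 0            ≡⟨ sym (Z-swap c e) ⟩
              T′.Z c e + J x                                    ≡⟨ cong (_+ J x) eq ⟩
              T′.M x + J x                                      ∎
            where
            open Range (range w)
            mX = exists-min (walk p q) (ℕ.≤-trans lo≤c c≤hi)
            m = W.pitman p q (ℕ.≤-trans lo≤c c≤hi) (proj₂ mX)
            o = arg (proj₂ mX)
            s = psum (hat B) e - psum (hat p) e

        -- By `M-swap` the increments of the two tandem minima differ by those of J, and q′ = q + ΔJ
        -- makes up for exactly this difference.
        act-swap : act q (act p B) ≡ act q′ (act p′ B)
        act-swap = hat-injective λ x → trans (hat-act q (act p B) x) (trans (eq x) (sym (hat-act q′ (act p′ B) x)))
          where
          eq : ∀ x → hat q x + Δ (act p B) q x ≡ hat q′ x + Δ (act p′ B) q′ x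
          eq x = sym (trans (cong (_+ Δ (act p′ B) q′ x) (hat-act q p x))
            (trans (+-assoc (hat q x) (Δ p q x) _) (cong (_+_ (hat q x)) (increments x))))
            where
            cancel : ∀ a b o → (a + o) - (b + o) ≡ a - b
            cancel = solve 3 (λ a b o → (a :+ o) :- (b :+ o) := a :- b) refl
            regroup : ∀ j₁ j₀ b₁ b₀ → (j₁ - j₀) + (b₁ - b₀) ≡ (b₁ + j₁) - (b₀ + j₀)
            regroup = solve 4 (λ j₁ j₀ b₁ b₀ → (j₁ :- j₀) :+ (b₁ :- b₀) := (b₁ :+ j₁) :- (b₀ :+ j₀)) refl
            increments : ∀ x → Δ p q x + Δ (act p′ B) q′ x ≡ Δ (act p B) q x
            increments x =
              trans (cong (_+_ (Δ p q x)) (sym (cancel (I (act p′ B) q′ (suc x)) (I (act p′ B) q′ x) (I B p′ 0))))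
              (trans (regroup (J (suc x)) (J x) (T′.M (suc x)) (T′.M x))
              (trans (cong₂ _-_ (M-swap (suc x)) (M-swap x))
              (trans (cancel (T.M (suc x)) (T.M x) (J 0)) (cancel (I (act p B) q (suc x)) (I (act p B) q x) (I B p 0)))))

-- Greedy placement of particles on a circle as a conserved flow.

module GreedyFilling where

  open import Data.Nat using (_+_; _≤_; z≤n; s≤s)
  open import Data.Nat.Properties
  open import Data.Nat.Solver using (module +-*-Solver)

  num : Bool → ℕ
  num true  = 1
  num false = 0

  tot : ∀ {n} → (Fin n → ℕ) → ℕ
  tot {zero}  f = 0
  tot {suc n} f = f Fin.zero + tot (f ∘ Fin.suc)

  tot-cong : ∀ {n} {f g : Fin n → ℕ} → (∀ i → f i ≡ g i) → tot f ≡ tot g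
  tot-cong {zero}  h = refl
  tot-cong {suc n} h = cong₂ _+_ (h Fin.zero) (tot-cong (h ∘ Fin.suc))

  tot-+ : ∀ {n} (f g : Fin n → ℕ) → tot (λ i → f i + g i) ≡ tot f + tot g
  tot-+ {zero}  f g = refl
  tot-+ {suc n} f g = trans (cong (f Fin.zero + g Fin.zero +_) (tot-+ (f ∘ Fin.suc) (g ∘ Fin.suc)))
    (solve 4 (λ a b c d → (a :+ b) :+ (c :+ d) := (a :+ c) :+ (b :+ d)) refl
      (f Fin.zero) (g Fin.zero) (tot (f ∘ Fin.suc)) (tot (g ∘ Fin.suc)))
    where open +-*-Solver

  tot-zero : ∀ n → tot {n} (λ _ → 0) ≡ 0
  tot-zero zero    = refl
  tot-zero (suc n) = tot-zero n

  tot-mono : ∀ {n} {f g : Fin n → ℕ} → (∀ i → f i ≤ g i) → tot f ≤ tot g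
  tot-mono {zero}  h = z≤n
  tot-mono {suc n} h = +-mono-≤ (h Fin.zero) (tot-mono (h ∘ Fin.suc))

  tot-squeeze : ∀ {n} {f g : Fin n → ℕ} → (∀ i → f i ≤ g i) → tot g ≤ tot f → ∀ i → f i ≡ g i
  tot-squeeze {suc n} {f} {g} h le Fin.zero = ≤-antisym (h Fin.zero)
    (+-cancelʳ-≤ (tot (f ∘ Fin.suc)) _ _
      (≤-trans (+-monoʳ-≤ (g Fin.zero) (tot-mono (h ∘ Fin.suc))) le))
  tot-squeeze {suc n} {f} {g} h le (Fin.suc i) = tot-squeeze (h ∘ Fin.suc)
    (+-cancelˡ-≤ (f Fin.zero) _ _ (≤-trans (+-monoˡ-≤ _ (h Fin.zero)) le)) i

  unit : ∀ {n} → Fin n → Fin n → ℕ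
  unit i j = num (does (i ≟ᶠ j))

  unit-refl : ∀ {n} (i : Fin n) → unit i i ≡ 1
  unit-refl i = cong num (dec-true (i ≟ᶠ i) refl)

  unit-≢ : ∀ {n} {i j : Fin n} → i ≢ j → unit i j ≡ 0
  unit-≢ {i = i} {j} ne = cong num (dec-false (i ≟ᶠ j) ne)

  unit-injective : ∀ {m n} (f : Fin m → Fin n) → (∀ {i j} → f i ≡ f j → i ≡ j) → ∀ i j → unit (f i) (f j) ≡ unit i j
  unit-injective f inj i j with i ≟ᶠ j
  ... | yes refl = unit-refl (f i)
  ... | no ne    = unit-≢ (ne ∘ inj)

  tot-unit : ∀ {n} (i : Fin n) → tot (unit i) ≡ 1
  tot-unit {suc n} Fin.zero    = cong suc (trans (tot-cong {n} (λ i → unit-≢ {i = Fin.zero} {Fin.suc i} λ ())) (tot-zero n))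
  tot-unit {suc n} (Fin.suc i) = trans (tot-cong (λ j → unit-injective Fin.suc Fin.suc-injective i j)) (tot-unit i)

  cnt : ∀ {n} → List (Fin n) → Fin n → ℕ
  cnt []      j = 0
  cnt (i ∷ L) j = unit i j + cnt L j

  tot-cnt : ∀ {n} (L : List (Fin n)) → tot (cnt L) ≡ length L
  tot-cnt {n} []  = tot-zero n
  tot-cnt (i ∷ L) = trans (tot-+ (unit i) (cnt L)) (cong₂ _+_ (tot-unit i) (tot-cnt L))

  tot-bits : ∀ {n} (q : Subset n) → tot (num ∘ lookup q) ≡ ∣ q ∣
  tot-bits []          = refl
  tot-bits (true ∷ q)  = cong suc (tot-bits q)
  tot-bits (false ∷ q) = tot-bits q

  path : ∀ {n} → (Fin n → Fin n) → Fin n → ℕ → List (Fin n)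
  path nx x zero    = []
  path nx x (suc k) = x ∷ path nx (nx x) k

  -- Particles S enter the open sites o moving along nx: d is the set of filled sites,
  -- Q y the number of particles that pass into y from the site before it.
  record Flow {n} (nx : Fin n → Fin n) (o d : Fin n → Bool) (S Q : Fin n → ℕ) : Set where
    constructor flow
    field
      balance : ∀ y → num (d y) + Q (nx y) ≡ S y + Q y
      sub     : ∀ y → d y ≡ true → o y ≡ true
      idle    : ∀ y → o y ≡ true → d y ≡ false → Q (nx y) ≡ 0

  open Flow

  Flow-cong : ∀ {n} {nx : Fin n → Fin n} {o o′ d d′ S S′ Q} →
              (∀ y → o y ≡ o′ y) → (∀ y → d y ≡ d′ y) → (∀ y → S y ≡ S′ y) → Flow nx o d S Q → Flow nx o′ d′ S′ Q
  Flow-cong {nx = nx} {Q = Q} o≡ d≡ S≡ (flow bal sb idl) = flow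
    (λ y → trans (cong (λ c → num c + Q (nx y)) (sym (d≡ y))) (trans (bal y) (cong (_+ Q y) (S≡ y))))
    (λ y e → trans (sym (o≡ y)) (sb y (trans (d≡ y) e)))
    (λ y e e′ → idl y (trans (o≡ y) e) (trans (d≡ y) e′))

  num-injective : ∀ {b c} → num b ≡ num c → b ≡ c
  num-injective {true}  {true}  _ = refl
  num-injective {false} {false} _ = refl

  tot-not : ∀ {n} (f : Fin n → Bool) → tot (num ∘ f) + tot (num ∘ not ∘ f) ≡ n
  tot-not {zero}  f = refl
  tot-not {suc n} f with f Fin.zero
  ... | true  = cong suc (tot-not (f ∘ Fin.suc))
  ... | false = trans (+-suc _ _) (cong suc (tot-not (f ∘ Fin.suc)))

  cnt-filter : ∀ {n} (P : Fin n → Bool) L y → cnt (filterᵇ P L) y ≡ (if P y then cnt L y else 0)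
  cnt-filter P []      y with P y
  ... | true  = refl
  ... | false = refl
  cnt-filter P (i ∷ L) y with i ≟ᶠ y
  cnt-filter P (i ∷ L) .i | yes refl with P i | cnt-filter P L i
  ... | true  | ih = cong₂ _+_ (unit-refl i) ih
  ... | false | ih = ih
  cnt-filter P (i ∷ L) y | no ne with P i
  ... | true  = trans (cong (_+ cnt (filterᵇ P L) y) (unit-≢ ne)) (cnt-filter P L y)
  ... | false = cnt-filter P L y

  cnt-filter-all : ∀ {n} (P : Fin n → Bool) L → (∀ y → cnt L y ≡ 1) → ∀ y → cnt (filterᵇ P L) y ≡ num (P y)
  cnt-filter-all P L h y with P y | cnt-filter P L y
  ... | true  | e = trans e (h y)
  ... | false | e = e

  length-filter : ∀ {n} (P : Fin n → Bool) L → (∀ y → cnt L y ≡ 1) → length (filterᵇ P L) ≡ tot (num ∘ P)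
  length-filter P L h = trans (sym (tot-cnt (filterᵇ P L))) (tot-cong (cnt-filter-all P L h))

  num-sub : ∀ {b c} → (b ≡ true → c ≡ true) → num b ≤ num c
  num-sub {false} h = z≤n
  num-sub {true}  h rewrite h refl = ≤-refl

  -- Both phases at once: `b` tells whether the sites inside or outside the queue are open, `nx` is
  -- the direction of search and `val` the letter written.
  module Greedy {n : ℕ} (q : Subset n) (b : Bool) (nx : Fin n → Fin n)
                (nx-injective : ∀ {i j} → nx i ≡ nx j → i ≡ j)
                (ls : Fin n → List (Fin n)) (ls-path : ∀ i → ls i ≡ path nx i n) (ls-all : ∀ i j → j ∈ ls i)
                (val : Fin n → ℕ) where

    o : Fin n → Bool
    o y = sameBool (lookup q y) b

    run : List (Fin n) → Vec (Maybe ℕ) n → Vec (Maybe ℕ) n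
    run []       v = v
    run (i ∷ is) v = run is (place (firstFree q b v (ls i)) (val i) v)

    -- Restricted to open sites because the vector may already hold the letters of the other phase.
    occ : (ℕ → Bool) → Vec (Maybe ℕ) n → Fin n → Bool
    occ P v y = o y ∧ maybe′ P false (lookup v y)

    free : Vec (Maybe ℕ) n → Fin n → Set
    free v y = o y ≡ true × lookup v y ≡ nothing

    firstFree-∷ : ∀ v k js → (free v k × firstFree q b v (k ∷ js) ≡ just k)
                           ⊎ (¬ free v k × firstFree q b v (k ∷ js) ≡ firstFree q b v js)
    firstFree-∷ v k js with lookup v k
    ... | just _  = inj₂ ((λ ()) , refl)
    ... | nothing with sameBool (lookup q k) b
    ...   | true  = inj₁ ((refl , refl) , refl)
    ...   | false = inj₂ ((λ ()) , refl)

    firstFree-just : ∀ v js {j} → firstFree q b v js ≡ just j → free v j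
    firstFree-just v (k ∷ js) eq with firstFree-∷ v k js
    ... | inj₁ (f , e) = subst (free v) (just-injective (trans (sym e) eq)) f
    ... | inj₂ (_ , e) = firstFree-just v js (trans (sym e) eq)

    firstFree-nothing : ∀ v js → firstFree q b v js ≡ nothing → ∀ {j} → j ∈ js → ¬ free v j
    firstFree-nothing v (k ∷ js) eq m with firstFree-∷ v k js | m
    ... | inj₁ (_ , e) | _         = contradiction (trans (sym eq) e) λ ()
    ... | inj₂ (nf , _) | here refl = nf
    ... | inj₂ (_ , e)  | there m′  = firstFree-nothing v js (trans (sym e) eq) m′

    -- The term `unit x y` is a particle already counted in `S` but still travelling, now at x. Each
    -- step adds one to the flow out of a site that is not free, so no free site passed nothing
    -- before and something now. The search stops with the particle at j.
    carry : ∀ v (d : Fin n → Bool) (S : Fin n → ℕ) x k (Q : Fin n → ℕ) {j} →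
            (∀ y → num (d y) + Q (nx y) + unit x y ≡ S y + Q y) →
            (∀ y → free v y → Q (nx y) ≡ 0) →
            firstFree q b v (path nx x k) ≡ just j →
            ∃ λ (Q′ : Fin n → ℕ) → (∀ y → num (d y) + Q′ (nx y) + unit j y ≡ S y + Q′ y) ×
                     (∀ y → free v y → y ≢ j → Q′ (nx y) ≡ 0)
    carry v d S x zero Q bal idl ()
    carry v d S x (suc k) Q {j} bal idl eq = go (firstFree-∷ v x (path nx (nx x) k))
      where
      open +-*-Solver
      Q₁ : Fin n → ℕ
      Q₁ y = Q y + unit (nx x) y
      bal₁ : ∀ y → num (d y) + Q₁ (nx y) + unit (nx x) y ≡ S y + Q₁ y
      bal₁ y = trans (cong (λ t → num (d y) + (Q (nx y) + t) + unit (nx x) y) (unit-injective nx nx-injective x y))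
        (trans (solve 4 (λ a c e f → (a :+ (c :+ e)) :+ f := ((a :+ c) :+ e) :+ f) refl
                 (num (d y)) (Q (nx y)) (unit x y) (unit (nx x) y))
          (trans (cong (_+ unit (nx x) y) (bal y)) (+-assoc (S y) (Q y) _)))
      idl₁ : ¬ free v x → ∀ y → free v y → Q₁ (nx y) ≡ 0
      idl₁ nf y fy = cong₂ _+_ (idl y fy)
        (trans (unit-injective nx nx-injective x y) (unit-≢ {i = x} {y} λ { refl → nf fy }))
      go : free v x × firstFree q b v (path nx x (suc k)) ≡ just x
         ⊎ ¬ free v x × firstFree q b v (path nx x (suc k)) ≡ firstFree q b v (path nx (nx x) k) →
           ∃ λ (Q′ : Fin n → ℕ) → (∀ y → num (d y) + Q′ (nx y) + unit j y ≡ S y + Q′ y) ×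
                    (∀ y → free v y → y ≢ j → Q′ (nx y) ≡ 0)
      go (inj₁ (_ , e)) = Q , (λ y → subst (λ z → num (d y) + Q (nx y) + unit z y ≡ S y + Q y) x≡j (bal y))
                            , λ y fy _ → idl y fy
        where
        x≡j : x ≡ j
        x≡j = just-injective (trans (sym e) eq)
      go (inj₂ (nf , e)) = carry v d S (nx x) k Q₁ bal₁ (idl₁ nf) (trans (sym e) eq)

    -- Links two notions of vacancy: under it an open site outside `occ P v` is really empty, so
    -- that `idle` speaks about free sites.
    Pure : (ℕ → Bool) → Vec (Maybe ℕ) n → Set
    Pure P v = ∀ y a → o y ≡ true → lookup v y ≡ just a → P a ≡ true

    record Inv (P : ℕ → Bool) (v : Vec (Maybe ℕ) n) (S : Fin n → ℕ) : Set where
      constructor inv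
      field
        Q     : Fin n → ℕ
        flows : Flow nx o (occ P v) S Q
        total : tot (num ∘ occ P v) ≡ tot S

    occ-free : ∀ P v y → free v y → occ P v y ≡ false
    occ-free P v y (oy , vy) rewrite oy | vy = refl

    occ-false : ∀ {P v} → Pure P v → ∀ y → o y ≡ true → occ P v y ≡ false → lookup v y ≡ nothing
    occ-false {P} {v} pure y oy e with lookup v y in vy
    ... | nothing = refl
    ... | just a rewrite oy = contradiction (trans (sym (pure y a oy vy)) e) λ ()

    occ-sub : ∀ P v y → occ P v y ≡ true → o y ≡ true
    occ-sub P v y e with o y
    ... | true = refl
    ... | false = e

    occ-place : ∀ P v j a → free v j → P a ≡ true → ∀ y → num (occ P (v [ j ]≔ just a) y) ≡ num (occ P v y) + unit j y
    occ-place P v j a (oj , vj) Pa y with j ≟ᶠ y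
    ... | yes refl rewrite oj | lookup∘updateAt j {λ _ → just a} v | vj | Pa = refl
    ... | no ne rewrite lookup∘updateAt′ y j {λ _ → just a} (ne ∘ sym) v = sym (+-identityʳ _)

    -- The strict bound leaves room: a failing search would mean that every open site belongs to
    -- `occ P v`, and the totals would agree.
    add : ∀ {P v S} i → Inv P v S → Pure P v → P (val i) ≡ true → suc (tot S) ≤ tot (num ∘ o) →
          let v′ = place (firstFree q b v (ls i)) (val i) v in
          Inv P v′ (λ y → unit i y + S y) × Pure P v′
    add {P} {v} {S} i (inv Q f t) pure Pi lt with firstFree q b v (ls i) in eq
    ... | nothing = contradiction lt (<-irrefl (trans (sym t) (tot-cong all-full)))
      where
      all-full : ∀ y → num (occ P v y) ≡ num (o y)
      all-full y with o y in oy
      ... | false = refl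
      ... | true with lookup v y in vy
      ...   | just a  = cong num (pure y a oy vy)
      ...   | nothing = contradiction (oy , vy) (firstFree-nothing v (ls i) eq (ls-all i y))
    ... | just j with firstFree-just v (ls i) eq
    ...   | fj@(oj , vj) = inv Q′ (flow bal (occ-sub P v′) idl) tot′ , pure′
      where
      v′ = v [ j ]≔ just (val i)
      c = carry v (occ P v) (λ y → unit i y + S y) i n Q {j}
            (λ y → trans (cong (_+ unit i y) (balance f y))
                     (trans (+-comm _ (unit i y)) (sym (+-assoc (unit i y) (S y) (Q y)))))
            (λ y fy → idle f y (proj₁ fy) (occ-free P v y fy))
            (subst (λ js → firstFree q b v js ≡ just j) (ls-path i) eq)
      Q′ = proj₁ c
      bal : ∀ y → num (occ P v′ y) + Q′ (nx y) ≡ unit i y + S y + Q′ y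
      bal y = trans (cong (_+ Q′ (nx y)) (occ-place P v j (val i) fj Pi y))
        (trans (solve 3 (λ a e f → (a :+ e) :+ f := (a :+ f) :+ e) refl (num (occ P v y)) (unit j y) (Q′ (nx y)))
          (proj₁ (proj₂ c) y))
        where open +-*-Solver
      pure′ : Pure P v′
      pure′ y a oy e with j ≟ᶠ y
      ... | yes refl = trans (cong P (just-injective (trans (sym e) (lookup∘updateAt j v)))) Pi
      ... | no ne = pure y a oy (trans (sym (lookup∘updateAt′ y j (ne ∘ sym) v)) e)
      idl : ∀ y → o y ≡ true → occ P v′ y ≡ false → Q′ (nx y) ≡ 0
      idl y oy e with j ≟ᶠ y | occ-false {P} {v′} pure′ y oy e
      ... | yes refl | w = contradiction (trans (sym w) (lookup∘updateAt j v)) λ ()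
      ... | no ne | w = proj₂ (proj₂ c) y (oy , trans (sym (lookup∘updateAt′ y j (ne ∘ sym) v)) w) (ne ∘ sym)
      tot′ : tot (num ∘ occ P v′) ≡ tot (λ y → unit i y + S y)
      tot′ = trans (tot-cong (occ-place P v j (val i) fj Pi))
        (trans (tot-+ (num ∘ occ P v) (unit j))
        (trans (cong₂ _+_ t (trans (tot-unit j) (sym (tot-unit i))))
        (trans (+-comm (tot S) _) (sym (tot-+ (unit i) S)))))

    place-keeps : ∀ v i y → ¬ free v y → lookup (place (firstFree q b v (ls i)) (val i) v) y ≡ lookup v y
    place-keeps v i y nf with firstFree q b v (ls i) in eq
    ... | nothing = refl
    ... | just j with j ≟ᶠ y
    ...   | yes refl = contradiction (firstFree-just v (ls i) eq) nf
    ...   | no ne = lookup∘updateAt′ y j (ne ∘ sym) v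

    run-closed : ∀ L v y → o y ≡ false → lookup (run L v) y ≡ lookup v y
    run-closed []      v y e = refl
    run-closed (i ∷ L) v y e = trans (run-closed L _ y e)
      (place-keeps v i y λ f → contradiction (trans (sym e) (proj₁ f)) λ ())

    -- A letter failing `P` only goes to an empty site, and it is not counted there either.
    occ-rest : ∀ P L v → All (λ i → P (val i) ≡ false) L → ∀ y → occ P (run L v) y ≡ occ P v y
    occ-rest P []      v []       y = refl
    occ-rest P (i ∷ L) v (e ∷ es) y = trans (occ-rest P L _ es y) one
      where
      one : occ P (place (firstFree q b v (ls i)) (val i) v) y ≡ occ P v y
      one with firstFree q b v (ls i) in eq
      ... | nothing = refl
      ... | just j with j ≟ᶠ y
      ...   | no ne rewrite lookup∘updateAt′ y j {λ _ → just (val i)} (ne ∘ sym) v = refl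
      ...   | yes refl with firstFree-just v (ls i) eq
      ...     | oj , vj rewrite lookup∘updateAt j {λ _ → just (val i)} v | vj | e = refl

    -- Sites with `P` come first in the processing order, so `occ P` is settled before any other
    -- letter competes for a site. For a single threshold the particles are then indistinguishable.
    Prefix : (ℕ → Bool) → List (Fin n) → Set
    Prefix P = AllPairs (λ i j → P (val j) ≡ true → P (val i) ≡ true)

    filter-none : ∀ {P : Fin n → Bool} {L} → All (λ i → P i ≡ false) L → filterᵇ P L ≡ []
    filter-none []       = refl
    filter-none (e ∷ es) rewrite e = filter-none es

    ¬true⇒false : ∀ {c : Bool} → ¬ (c ≡ true) → c ≡ false
    ¬true⇒false {true}  h = contradiction refl h
    ¬true⇒false {false} h = refl

    run-inv : ∀ P L v S → Prefix P L → Inv P v S → Pure P v → tot S + length L ≤ tot (num ∘ o) →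
              Inv P (run L v) (λ y → cnt (filterᵇ (P ∘ val) L) y + S y)
    run-inv P []      v S _  I pure le = I
    run-inv P (i ∷ L) v S (h ∷ pf) I pure le with P (val i) in Pi
    ... | true with add {P} {v} {S} i I pure Pi
                    (≤-trans (≤-trans (s≤s (m≤m+n (tot S) (length L))) (≤-reflexive (sym (+-suc (tot S) (length L))))) le)
    ...   | I₁ , pure₁ with run-inv P L _ _ pf I₁ pure₁
                         (≤-trans (≤-reflexive (trans
                           (cong (_+ length L) (trans (tot-+ (unit i) S) (cong (_+ tot S) (tot-unit i))))
                           (sym (+-suc (tot S) (length L))))) le)
    ...     | inv Q (flow bal sb idl) t = inv Q
              (flow (λ y → trans (bal y) (cong (_+ Q y) (swap y))) sb idl)
              (trans t (tot-cong swap))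
      where
      open +-*-Solver
      swap : ∀ y → cnt (filterᵇ (P ∘ val) L) y + (unit i y + S y) ≡ unit i y + cnt (filterᵇ (P ∘ val) L) y + S y
      swap y = solve 3 (λ a c e → a :+ (c :+ e) := (c :+ a) :+ e) refl (cnt (filterᵇ (P ∘ val) L) y) (unit i y) (S y)
    run-inv P (i ∷ L) v S (h ∷ pf) (inv Q (flow bal sb idl) t) pure le | false = inv Q
        (flow (λ y → trans (cong (λ c → num c + Q (nx y)) (same y)) (trans (bal y) (cong (λ M → cnt M y + S y + Q y) (sym none))))
              (occ-sub P (run (i ∷ L) v))
              (λ y oy e → idl y oy (trans (sym (same y)) e)))
        (trans (tot-cong (cong num ∘ same)) (trans t (tot-cong λ y → cong (λ M → cnt M y + S y) (sym none))))
      where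
      rest : All (λ j → P (val j) ≡ false) L
      rest = All.map (λ g → ¬true⇒false λ e → contradiction (g e) λ ()) h
      none : filterᵇ (P ∘ val) L ≡ []
      none = filter-none rest
      same : ∀ y → occ P (run (i ∷ L) v) y ≡ occ P v y
      same = occ-rest P (i ∷ L) v (Pi ∷ rest)

    filter-take : ∀ P r L → Prefix P L → filterᵇ (P ∘ val) (take r L) ≡ take r (filterᵇ (P ∘ val) L)
    filter-take P zero    L       pf = refl
    filter-take P (suc r) []      pf = refl
    filter-take P (suc r) (i ∷ L) (h ∷ pf) with P (val i)
    ... | true  = cong (i ∷_) (filter-take P r L pf)
    ... | false = trans (trans (filter-take P r L pf) (cong (take r) none)) (trans (take-[] r) (sym (cong (take (suc r)) none)))
      where
      none : filterᵇ (P ∘ val) L ≡ []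
      none = filter-none (All.map (λ g → ¬true⇒false λ e → contradiction (g e) λ ()) h)
      take-[] : ∀ r → take {A = Fin n} r [] ≡ []
      take-[] zero    = refl
      take-[] (suc r) = refl

    empty-inv : ∀ P v → (∀ y → o y ≡ true → lookup v y ≡ nothing) → Inv P v (λ _ → 0) × Pure P v
    empty-inv P v empty = inv (λ _ → 0)
        (flow (λ y → cong (λ c → num c + 0) (occ-empty y)) (occ-sub P v) (λ _ _ _ → refl))
        (tot-cong (cong num ∘ occ-empty))
      , λ y a oy e → contradiction (trans (sym (empty y oy)) e) λ ()
      where
      occ-empty : ∀ y → occ P v y ≡ false
      occ-empty y with o y in oy
      ... | false = refl
      ... | true rewrite empty y oy = refl

    module Phase (P : ℕ → Bool) (s : List (Fin n)) (s-all : ∀ y → cnt s y ≡ 1) (prefix : Prefix P s)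
                 (r : ℕ) (r≡ : tot (num ∘ o) ≡ r)
                 (v : Vec (Maybe ℕ) n) (empty : ∀ y → o y ≡ true → lookup v y ≡ nothing) where

      final : Vec (Maybe ℕ) n
      final = run (take r s) v

      hits : List (Fin n)
      hits = filterᵇ (P ∘ val) s

      final-inv : Inv P final (λ y → cnt (take r hits) y + 0)
      final-inv = subst (λ M → Inv P final (λ y → cnt M y + 0)) (filter-take P r s prefix)
        (run-inv P (take r s) v (λ _ → 0) (AllPairs.take⁺ r prefix)
          (proj₁ (empty-inv P v empty)) (proj₂ (empty-inv P v empty))
          (subst₂ _≤_ (sym (cong₂ _+_ (tot-zero n) (length-take r s))) (sym r≡) (m⊓n≤m r (length s))))

      -- Few enough particles: cutting the list to its first r sites loses none of those satisfying
      -- `P`.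
      final-small : tot (num ∘ P ∘ val) ≤ r →
                    ∃ λ Q → Flow nx o (occ P final) (num ∘ P ∘ val) Q × tot (num ∘ occ P final) ≡ tot (num ∘ P ∘ val)
      final-small le = Inv.Q final-inv
        , Flow-cong (λ _ → refl) (λ _ → refl) same (Inv.flows final-inv)
        , trans (Inv.total final-inv) (tot-cong same)
        where
        same : ∀ y → cnt (take r hits) y + 0 ≡ num (P (val y))
        same y = trans (+-identityʳ _) (trans
          (cong (λ M → cnt M y) (take-all r hits (subst (_≤ r) (sym (length-filter (P ∘ val) s s-all)) le)))
          (cnt-filter-all (P ∘ val) s s-all y))

      -- Here r particles satisfying `P` are placed, as many as there are open sites; a subset of
      -- full size is everything.
      final-big : r ≤ tot (num ∘ P ∘ val) → ∀ y → occ P final y ≡ o y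
      final-big le y = num-injective (tot-squeeze (λ i → num-sub (occ-sub P final i)) (≤-reflexive (sym total)) y)
        where
        total : tot (num ∘ occ P final) ≡ tot (num ∘ o)
        total = trans (Inv.total final-inv) (trans (tot-cong (λ y → +-identityʳ (cnt (take r hits) y)))
          (trans (tot-cnt (take r hits)) (trans (length-take r hits)
          (trans (m≤n⇒m⊓n≡m (subst (r ≤_) (sym (length-filter (P ∘ val) s s-all)) le)) (sym r≡)))))

-- A flow on the circle is the window-minimum action.

module FlowAction where

  open import Data.Integer using (+_; 0ℤ; 1ℤ; _+_; _-_; -_; _≤_)
  open import Data.Integer.Properties renaming (_≟_ to _≟ᶻ_)
  open import Data.Integer.Solver using (module +-*-Solver)
  open +-*-Solver
  open WindowMinimum
  open QueueAction
  open GreedyFilling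
  open IsMin
  open Flow

  -- Supplies the minimiser for queues running right: `V` moves only in steps that end with an empty
  -- queue, so after the last such moment it keeps its final value.
  last-idle : ∀ (R V : ℕ → ℤ) → (∀ x → R (suc x) ≡ 0ℤ ⊎ V (suc x) ≡ V x) → ∀ c₀ k → R c₀ ≡ 0ℤ →
              ∃ λ c → c₀ ℕ.≤ c × c ℕ.≤ c₀ ℕ.+ k × R c ≡ 0ℤ × V c ≡ V (c₀ ℕ.+ k)
  last-idle R V h c₀ zero z = c₀ , ℕ.≤-refl , ℕ.m≤m+n c₀ 0 , z , cong V (sym (ℕ.+-identityʳ c₀))
  last-idle R V h c₀ (suc k) z with h (c₀ ℕ.+ k)
  ... | inj₁ z′ = c₀ ℕ.+ suc k , ℕ.m≤m+n c₀ (suc k) , ℕ.≤-refl , trans (cong R (ℕ.+-suc c₀ k)) z′ , refl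
  ... | inj₂ e with last-idle R V h c₀ k z
  ...   | c , p , r , z′ , e′ = c , p , ℕ.≤-trans r (ℕ.+-monoʳ-≤ c₀ (ℕ.n≤1+n k)) , z′
                              , trans e′ (trans (sym e) (cong V (sym (ℕ.+-suc c₀ k))))

  first-idle : ∀ (R V : ℕ → ℤ) → (∀ x → R x ≡ 0ℤ ⊎ V (suc x) ≡ V x) → ∀ x k → R (x ℕ.+ k) ≡ 0ℤ →
               ∃ λ c → x ℕ.≤ c × c ℕ.≤ x ℕ.+ k × R c ≡ 0ℤ × V c ≡ V x
  first-idle R V h x zero z = x , ℕ.≤-refl , ℕ.m≤m+n x 0 , trans (cong R (sym (ℕ.+-identityʳ x))) z , refl
  first-idle R V h x (suc k) z with h x
  ... | inj₁ z′ = x , ℕ.≤-refl , ℕ.m≤m+n x (suc k) , z′ , refl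
  ... | inj₂ e with first-idle R V h (suc x) k (trans (cong R (sym (ℕ.+-suc x k))) z)
  ...   | c , p , r , z′ , e′ = c , ℕ.<⇒≤ p , subst (c ℕ.≤_) (sym (ℕ.+-suc x k)) r , z′ , trans e′ e

  decreasing : ∀ (V : ℕ → ℤ) → (∀ x → V (suc x) ≤ V x) → ∀ c k → V (c ℕ.+ k) ≤ V c
  decreasing V h c zero    = ≤-reflexive (cong V (ℕ.+-identityʳ c))
  decreasing V h c (suc k) = ≤-trans (≤-reflexive (cong V (ℕ.+-suc c k))) (≤-trans (h (c ℕ.+ k)) (decreasing V h c k))

  increasing : ∀ (V : ℕ → ℤ) → (∀ x → V x ≤ V (suc x)) → ∀ c k → V c ≤ V (c ℕ.+ k)
  increasing V h c zero    = ≤-reflexive (cong V (sym (ℕ.+-identityʳ c)))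
  increasing V h c (suc k) = ≤-trans (increasing V h c k) (≤-trans (h (c ℕ.+ k)) (≤-reflexive (cong V (sym (ℕ.+-suc c k)))))

  applyUpTo-path : ∀ {n} (nx : Fin n → Fin n) g k → (∀ t → suc t ℕ.< k → nx (g t) ≡ g (suc t)) →
                   applyUpTo g k ≡ path nx (g 0) k
  applyUpTo-path nx g zero    h = refl
  applyUpTo-path nx g (suc zero) h = refl
  applyUpTo-path nx g (suc (suc k)) h = cong (g 0 ∷_)
    (trans (applyUpTo-path nx (g ∘ suc) (suc k) (λ t lt → h (suc t) (ℕ.s≤s lt)))
           (cong (λ x → path nx x (suc k)) (sym (h 0 (ℕ.s≤s (ℕ.s≤s ℕ.z≤n))))))

  bit-num : ∀ b → + num b ≡ bit b
  bit-num true  = refl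
  bit-num false = refl

  bit-not : ∀ b → bit (not b) ≡ 1ℤ - bit b
  bit-not true  = refl
  bit-not false = refl

  bit-mono : ∀ {b c} → (b ≡ true → c ≡ true) → bit b ≤ bit c
  bit-mono {false} {c} h = bit≥0 c
  bit-mono {true}  {c} h rewrite h refl = ≤-refl

  module Motion (n : ℕ) .{{_ : NonZero n}} where
    open Queues n

    next prev : Fin n → Fin n
    next i = site n (suc (toℕ i))
    prev i = site n (toℕ i ℕ.+ (n ℕ.∸ 1))

    suc-n∸1 : suc (n ℕ.∸ 1) ≡ n
    suc-n∸1 = ℕ.m+[n∸m]≡n (ℕ.>-nonZero⁻¹ n)

    next-site : ∀ x → next (site n x) ≡ site n (suc x)
    next-site = at-site (λ y → site n (suc y)) (λ x → site-periodic (suc x))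

    prev-site : ∀ x → prev (site n (suc x)) ≡ site n x
    prev-site x = trans
      (at-site (λ y → site n (y ℕ.+ (n ℕ.∸ 1)))
         (λ y → trans (cong (site n) (trans (ℕ.+-assoc y n _) (trans (cong (y ℕ.+_) (ℕ.+-comm n _)) (sym (ℕ.+-assoc y _ n)))))
                      (site-periodic (y ℕ.+ (n ℕ.∸ 1)))) (suc x))
      (trans (cong (site n) (trans (sym (ℕ.+-suc x _)) (cong (x ℕ.+_) suc-n∸1))) (site-periodic x))

    site-suc : ∀ i → site n (suc (toℕ i ℕ.+ (n ℕ.∸ 1))) ≡ i
    site-suc i = trans (cong (site n) (trans (sym (ℕ.+-suc (toℕ i) _)) (cong (toℕ i ℕ.+_) suc-n∸1)))
      (trans (site-periodic (toℕ i)) (site-toℕ i))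

    prev-next : ∀ i → prev (next i) ≡ i
    prev-next i = trans (prev-site (toℕ i)) (site-toℕ i)

    next-prev : ∀ i → next (prev i) ≡ i
    next-prev i = trans (next-site _) (site-suc i)

    next-injective : ∀ {i j} → next i ≡ next j → i ≡ j
    next-injective {i} {j} e = trans (sym (prev-next i)) (trans (cong prev e) (prev-next j))

    prev-injective : ∀ {i j} → prev i ≡ prev j → i ≡ j
    prev-injective {i} {j} e = trans (sym (next-prev i)) (trans (cong next e) (next-prev j))

    rightOf-path : ∀ i → rightOf n i ≡ path next i n
    rightOf-path i = trans (map-upTo _ n) (trans
      (applyUpTo-path next (λ t → site n (toℕ i ℕ.+ t)) n
        (λ t _ → trans (next-site _) (cong (site n) (sym (ℕ.+-suc (toℕ i) t)))))
      (cong (λ x → path next x n) (trans (cong (site n) (ℕ.+-identityʳ _)) (site-toℕ i))))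

    leftOf-path : ∀ i → leftOf n i ≡ path prev i n
    leftOf-path i = trans (map-upTo _ n) (trans
      (applyUpTo-path prev (λ t → site n (toℕ i ℕ.+ n ℕ.∸ t)) n
        (λ t lt → trans (cong (prev ∘ site n) (sym (suc-∸ t lt))) (prev-site _)))
      (cong (λ x → path prev x n) (trans (site-periodic (toℕ i)) (site-toℕ i))))
      where
      suc-∸ : ∀ t → suc t ℕ.< n → suc (toℕ i ℕ.+ n ℕ.∸ suc t) ≡ toℕ i ℕ.+ n ℕ.∸ t
      suc-∸ t lt = sym (ℕ.+-∸-assoc 1 {toℕ i ℕ.+ n} {suc t} (ℕ.≤-trans (ℕ.<⇒≤ lt) (ℕ.m≤n+m n (toℕ i))))

    offset-right : ∀ i j → ∃ λ t → t ℕ.< n × site n (toℕ i ℕ.+ t) ≡ j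
    offset-right i j with ℕ.≤-total (toℕ i) (toℕ j)
    ... | inj₁ p = toℕ j ℕ.∸ toℕ i , ℕ.≤-<-trans (ℕ.m∸n≤m (toℕ j) (toℕ i)) (toℕ<n j)
                 , trans (cong (site n) (ℕ.m+[n∸m]≡n p)) (site-toℕ j)
    ... | inj₂ p with ℕ.m≤n⇒m<n∨m≡n p
    ...   | inj₂ e = 0 , ℕ.>-nonZero⁻¹ n , trans (cong (site n) (trans (ℕ.+-identityʳ _) (sym e))) (site-toℕ j)
    ...   | inj₁ lt = toℕ j ℕ.+ n ℕ.∸ toℕ i
                 , ℕ.+-cancelˡ-< (toℕ i) _ _ (subst (ℕ._< toℕ i ℕ.+ n) (sym e) (ℕ.+-monoˡ-< n lt))
                 , trans (cong (site n) e) (trans (site-periodic (toℕ j)) (site-toℕ j))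
      where
      e : toℕ i ℕ.+ (toℕ j ℕ.+ n ℕ.∸ toℕ i) ≡ toℕ j ℕ.+ n
      e = ℕ.m+[n∸m]≡n (ℕ.≤-trans (ℕ.<⇒≤ (toℕ<n i)) (ℕ.m≤n+m n (toℕ j)))

    offset-left : ∀ i j → ∃ λ t → t ℕ.< n × site n (toℕ i ℕ.+ n ℕ.∸ t) ≡ j
    offset-left i j with offset-right j i
    ... | t , lt , e = t , lt , trans (trans (cong (site n) (ℕ.+-∸-assoc (toℕ i) (ℕ.<⇒≤ lt)))
          (trans (sym (at-site F per _)) (trans (cong (λ z → F (toℕ z)) (trans (site-toℕ i) (sym e)))
          (at-site F per _)))) (trans (cong (site n) (trans (ℕ.+-assoc (toℕ j) t _) (cong (toℕ j ℕ.+_) (ℕ.m+[n∸m]≡n (ℕ.<⇒≤ lt)))))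
            (trans (site-periodic (toℕ j)) (site-toℕ j)))
      where
      F : ℕ → Fin n
      F y = site n (y ℕ.+ (n ℕ.∸ t))
      per : ∀ y → F (y ℕ.+ n) ≡ F y
      per y = trans (cong (site n) (trans (ℕ.+-assoc y n _) (trans (cong (y ℕ.+_) (ℕ.+-comm n _)) (sym (ℕ.+-assoc y _ n)))))
                    (site-periodic (y ℕ.+ (n ℕ.∸ t)))

    rightOf-all : ∀ i j → j ∈ rightOf n i
    rightOf-all i j with offset-right i j
    ... | t , lt , refl = subst (site n (toℕ i ℕ.+ t) ∈_) (sym (map-upTo _ n)) (∈-applyUpTo⁺ (λ t → site n (toℕ i ℕ.+ t)) lt)

    leftOf-all : ∀ i j → j ∈ leftOf n i
    leftOf-all i j with offset-left i j
    ... | t , lt , refl = subst (site n (toℕ i ℕ.+ n ℕ.∸ t) ∈_) (sym (map-upTo _ n)) (∈-applyUpTo⁺ (λ t → site n (toℕ i ℕ.+ n ℕ.∸ t)) lt)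

    offset : ∀ x j → ∃ λ t → t ℕ.< n × site n (x ℕ.+ t) ≡ j
    offset x j with offset-right (site n x) j
    ... | t , lt , e = t , lt , trans (sym (at-site (λ y → site n (y ℕ.+ t)) per x)) e
      where
      per : ∀ y → site n (y ℕ.+ n ℕ.+ t) ≡ site n (y ℕ.+ t)
      per y = trans (cong (site n) (trans (ℕ.+-assoc y n t) (trans (cong (y ℕ.+_) (ℕ.+-comm n t)) (sym (ℕ.+-assoc y t n)))))
                    (site-periodic (y ℕ.+ t))

    -- `R` is the number waiting on arrival at x. By balance `V` drops by one at each service that
    -- finds nobody and is otherwise constant: up to a constant it is minus the number of idle
    -- services.
    module RightFlow (q B : Subset n) (d : Subset n) (Q : Fin n → ℕ)
                     (f : Flow next (lookup q) (lookup d) (num ∘ lookup B) Q) (size : ∣ d ∣ ≡ ∣ B ∣) where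

      R V : ℕ → ℤ
      R x = + Q (site n x)
      V x = walk B q x - R x

      R-step : ∀ x → hat d x + R (suc x) ≡ hat B x + R x
      R-step x = trans
        (cong₂ _+_ (sym (bit-num (lookup d (site n x)))) (cong (+_ ∘ Q) (sym (next-site x))))
        (trans (cong +_ (balance f (site n x))) (cong (_+ R x) (bit-num (lookup B (site n x)))))

      V-step : ∀ x → V (suc x) - V x ≡ hat d x - hat q x
      V-step x = ≡-by (sym (R-step x)) (eq (walk B q x) (hat B x) (hat q x) (R x) (R (suc x)) (hat d x))
        where
        eq : ∀ w b c r s d → (d - c) - (((w + (b - c)) - s) - (w - r)) ≡ (d + s) - (b + r) 
        eq = solve 6 (λ w b c r s d → (d :- c) :- (((w :+ (b :- c)) :- s) :- (w :- r)) := (d :+ s) :- (b :+ r)) refl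

      step-cases : ∀ x → R (suc x) ≡ 0ℤ ⊎ V (suc x) ≡ V x
      step-cases x = go (lookup d (site n x)) (lookup q (site n x)) refl refl
        where
        level : lookup d (site n x) ≡ lookup q (site n x) → V (suc x) ≡ V x
        level e = i-j≡0⇒i≡j _ _ (trans (V-step x) (i≡j⇒i-j≡0 (cong bit e)))
        go : ∀ b c → lookup d (site n x) ≡ b → lookup q (site n x) ≡ c → R (suc x) ≡ 0ℤ ⊎ V (suc x) ≡ V x
        go false true  dx qx = inj₁ (cong +_ (trans (cong Q (sym (next-site x))) (idle f (site n x) qx dx)))
        go true  false dx qx = contradiction (trans (sym qx) (sub f (site n x) dx)) λ ()
        go true  true  dx qx = inj₂ (level (trans dx (sym qx)))
        go false false dx qx = inj₂ (level (trans dx (sym qx)))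

      V-decreasing : ∀ x → V (suc x) ≤ V x
      V-decreasing x = ≤-by (bit-mono (sub f (site n x)))
        (trans (neg-sub (V x) (V (suc x))) (trans (cong -_ (V-step x)) (sym (neg-sub (hat q x) (hat d x)))))
        where
        neg-sub : ∀ a b → a - b ≡ - (b - a)
        neg-sub = solve 2 (λ a b → a :- b := :- (b :- a)) refl

      V≤walk : ∀ x → V x ≤ walk B q x
      V≤walk x = i-j≤i (walk B q x) (R x)

      R-periodic : ∀ x → R (x ℕ.+ n) ≡ R x
      R-periodic x = cong (+_ ∘ Q) (site-periodic x)

      V-periodic : ∀ x → V (x ℕ.+ n) ≡ V x + walk B q n
      V-periodic x = trans (cong₂ _-_ (walk-periodic B q x) (R-periodic x)) (eq (walk B q x) (walk B q n) (R x))
        where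
        eq : ∀ w δ r → (w + δ) - r ≡ (w - r) + δ
        eq = solve 3 (λ w δ r → (w :+ δ) :- r := (w :- r) :+ δ) refl

      -- `V` decreases and lies below the walk, so its value at the right end bounds the window. The
      -- two meet where the queue was last empty; the idle site i ensures that this happens inside
      -- the window.
      I≡V : ∀ i → Q (next i) ≡ 0 → ∀ x → I B q x ≡ V (x ℕ.+ n)
      I≡V i z x with offset x (next i)
      ... | t , lt , e with last-idle R V step-cases (x ℕ.+ t) (n ℕ.∸ t) (cong +_ (trans (cong Q e) z))
      ...   | c , p , r , Rc , Vc = IsMin-unique (W.I-isMin B q x) (isMin low c (ℕ.≤-trans (ℕ.m≤m+n x t) p) (subst (c ℕ.≤_) end r) att′)
        where
        end : x ℕ.+ t ℕ.+ (n ℕ.∸ t) ≡ x ℕ.+ n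
        end = trans (ℕ.+-assoc x t _) (cong (x ℕ.+_) (ℕ.m+[n∸m]≡n (ℕ.<⇒≤ lt)))
        low : ∀ c → x ℕ.≤ c → c ℕ.≤ x ℕ.+ n → V (x ℕ.+ n) ≤ walk B q c
        low c p r = ≤-trans (subst (λ y → V y ≤ V c) (ℕ.m+[n∸m]≡n r) (decreasing V V-decreasing c (x ℕ.+ n ℕ.∸ c))) (V≤walk c)
        att′ : walk B q c ≡ V (x ℕ.+ n)
        att′ = trans (sym (+-identityʳ _)) (trans (cong (λ r → walk B q c - r) (sym Rc)) (trans Vc (cong V end)))

      flow-act : d ≡ act q B
      flow-act with all? (λ i → lookup d i ≟ᵇ lookup q i)
      -- Every service is taken: sizes agree and the walk has no drift.
      ... | yes h = trans d≡q (sym (act-same-size q B (trans (sym size) (cong ∣_∣ d≡q))))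
        where
        d≡q : d ≡ q
        d≡q = lookup-ext h
      ... | no ¬h with ¬∀⟶∃¬ n _ (λ i → lookup d i ≟ᵇ lookup q i) ¬h
      ...   | i , ne = hat-injective λ x → sym (trans (hat-act q B x) (≡-by (V-step x) (eq x)))
        where
        z : Q (next i) ≡ 0
        z with lookup d i in di | lookup q i in qi
        ... | false | true  = idle f i qi di
        ... | true  | false = contradiction (trans (sym qi) (sub f i di)) λ ()
        ... | true  | true  = contradiction refl ne
        ... | false | false = contradiction refl ne
        ring : ∀ h k a b δ → k - (h + ((a + δ) - (b + δ))) ≡ (k - h) - (a - b)
        ring = solve 5 (λ h k a b δ → k :- (h :+ ((a :+ δ) :- (b :+ δ))) := (k :- h) :- (a :- b)) refl
        eq : ∀ x → hat d x - (hat q x + Δ B q x) ≡ (hat d x - hat q x) - (V (suc x) - V x)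
        eq x = trans (cong (λ t → hat d x - (hat q x + t))
                  (cong₂ _-_ (trans (I≡V i z (suc x)) (V-periodic (suc x))) (trans (I≡V i z x) (V-periodic x))))
                (ring (hat q x) (hat d x) (V (suc x)) (V x) (walk B q n))

    -- The particles are now the sites outside B, moving left into sites outside q. `R x` counts
    -- crossings of the same edge between x - 1 and x as in `RightFlow`, hence the `prev`. `V`
    -- increases, by one at each open site left empty, so it is the left end of the window that
    -- gives the minimum.
    module LeftFlow (q B : Subset n) (d : Subset n) (Q : Fin n → ℕ)
                    (f : Flow prev (not ∘ lookup q) (not ∘ lookup d) (num ∘ not ∘ lookup B) Q) (size : ∣ d ∣ ≡ ∣ B ∣) where

      R V : ℕ → ℤ
      R x = + Q (prev (site n x))
      V x = walk B q x - R x

      R-suc : ∀ x → R (suc x) ≡ + Q (site n x)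
      R-suc x = cong (+_ ∘ Q) (prev-site x)

      R-step : ∀ x → (1ℤ - hat d x) + R x ≡ (1ℤ - hat B x) + R (suc x)
      R-step x = trans
        (cong (_+ R x) (sym (trans (bit-num (not (lookup d (site n x)))) (bit-not (lookup d (site n x))))))
        (trans (cong +_ (balance f (site n x)))
          (cong₂ _+_ (trans (bit-num (not (lookup B (site n x)))) (bit-not (lookup B (site n x)))) (sym (R-suc x))))

      V-step : ∀ x → V (suc x) - V x ≡ hat d x - hat q x
      V-step x = ≡-by (R-step x) (eq (walk B q x) (hat B x) (hat q x) (R x) (R (suc x)) (hat d x))
        where
        eq : ∀ w b c r s d → (d - c) - (((w + (b - c)) - s) - (w - r)) ≡ ((1ℤ - b) + s) - ((1ℤ - d) + r)
        eq = solve 6 (λ w b c r s d → (d :- c) :- (((w :+ (b :- c)) :- s) :- (w :- r))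
                                   := ((con 1ℤ :- b) :+ s) :- ((con 1ℤ :- d) :+ r)) refl

      sub′ : ∀ i → lookup q i ≡ true → lookup d i ≡ true
      sub′ i qi with lookup d i in di
      ... | true  = refl
      ... | false = contradiction (trans (cong not (sym qi)) (sub f i (cong not di))) λ ()

      step-cases : ∀ x → R x ≡ 0ℤ ⊎ V (suc x) ≡ V x
      step-cases x = go (lookup d (site n x)) (lookup q (site n x)) refl refl
        where
        level : lookup d (site n x) ≡ lookup q (site n x) → V (suc x) ≡ V x
        level e = i-j≡0⇒i≡j _ _ (trans (V-step x) (i≡j⇒i-j≡0 (cong bit e)))
        go : ∀ b c → lookup d (site n x) ≡ b → lookup q (site n x) ≡ c → R x ≡ 0ℤ ⊎ V (suc x) ≡ V x
        go true  false dx qx = inj₁ (cong +_ (idle f (site n x) (cong not qx) (cong not dx)))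
        go false true  dx qx = contradiction (trans (sym dx) (sub′ (site n x) qx)) λ ()
        go true  true  dx qx = inj₂ (level (trans dx (sym qx)))
        go false false dx qx = inj₂ (level (trans dx (sym qx)))

      V-increasing : ∀ x → V x ≤ V (suc x)
      V-increasing x = ≤-by (bit-mono (sub′ (site n x))) (V-step x)

      V≤walk : ∀ x → V x ≤ walk B q x
      V≤walk x = i-j≤i (walk B q x) (R x)

      I≡V : ∀ i → Q (prev i) ≡ 0 → ∀ x → I B q x ≡ V x
      I≡V i z x with offset x i
      ... | t , lt , e with first-idle R V step-cases x t (cong +_ (trans (cong (Q ∘ prev) e) z))
      ...   | c , p , r , Rc , Vc = IsMin-unique (W.I-isMin B q x) (isMin low c p (ℕ.≤-trans r (ℕ.+-monoʳ-≤ x (ℕ.<⇒≤ lt))) att′)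
        where
        low : ∀ c → x ℕ.≤ c → c ℕ.≤ x ℕ.+ n → V x ≤ walk B q c
        low c p _ = ≤-trans (subst (λ y → V x ≤ V y) (ℕ.m+[n∸m]≡n p) (increasing V V-increasing x (c ℕ.∸ x))) (V≤walk c)
        att′ : walk B q c ≡ V x
        att′ = trans (sym (+-identityʳ _)) (trans (cong (λ r → walk B q c - r) (sym Rc)) Vc)

      flow-act : d ≡ act q B
      flow-act with all? (λ i → lookup d i ≟ᵇ lookup q i)
      ... | yes h = trans d≡q (sym (act-same-size q B (trans (sym size) (cong ∣_∣ d≡q))))
        where
        d≡q : d ≡ q
        d≡q = lookup-ext h
      ... | no ¬h with ¬∀⟶∃¬ n _ (λ i → lookup d i ≟ᵇ lookup q i) ¬h
      ...   | i , ne = hat-injective λ x → sym (trans (hat-act q B x) (≡-by (V-step x) (eq x)))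
        where
        z : Q (prev i) ≡ 0
        z with lookup d i in di | lookup q i in qi
        ... | true  | false = idle f i (cong not qi) (cong not di)
        ... | false | true  = contradiction (trans (sym di) (sub′ i qi)) λ ()
        ... | true  | true  = contradiction refl ne
        ... | false | false = contradiction refl ne
        ring : ∀ h k t → k - (h + t) ≡ (k - h) - t
        ring = solve 3 (λ h k t → k :- (h :+ t) := (k :- h) :- t) refl
        eq : ∀ x → hat d x - (hat q x + Δ B q x) ≡ (hat d x - hat q x) - (V (suc x) - V x)
        eq x = trans (cong (λ t → hat d x - (hat q x + t)) (cong₂ _-_ (I≡V i z (suc x)) (I≡V i z x)))
                (ring (hat q x) (hat d x) (V (suc x) - V x))

-- Threshold sets of the word produced by a queue.

module Thresholds where

  open import Data.Nat using (_+_; _≤_; _<_; _≤ᵇ_; _<ᵇ_)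
  open import Data.Nat.Properties
  open QueueAction
  open GreedyFilling
  open FlowAction

  <ᵇ-true⇒< : ∀ a k → (a <ᵇ k) ≡ true → a < k
  <ᵇ-true⇒< a k e = <ᵇ⇒< a k (Equivalence.from T-≡ e)

  <⇒<ᵇ-true : ∀ a k → a < k → (a <ᵇ k) ≡ true
  <⇒<ᵇ-true a k p = Equivalence.to T-≡ (<⇒<ᵇ p)

  Sorted : ∀ {n} → Word n → List (Fin n) → Set
  Sorted u = AllPairs (λ i j → lookup u i ≤ lookup u j)

  module _ {n} (u : Word n) where

    insertBy-All : ∀ {p} {P : Fin n → Set p} {j ks} → P j → All P ks → All P (insertBy u j ks)
    insertBy-All pj [] = pj ∷ []
    insertBy-All {j = j} {k ∷ ks} pj (pk ∷ pks) with lookup u j ≤ᵇ lookup u k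
    ... | true  = pj ∷ pk ∷ pks
    ... | false = pk ∷ insertBy-All pj pks

    insertBy-sorted : ∀ j ks → Sorted u ks → Sorted u (insertBy u j ks)
    insertBy-sorted j [] [] = [] ∷ []
    insertBy-sorted j (k ∷ ks) (h ∷ s) with lookup u j ≤ᵇ lookup u k in e
    ... | true  = (j≤k ∷ All.map (≤-trans j≤k) h) ∷ h ∷ s
      where
      j≤k : lookup u j ≤ lookup u k
      j≤k = ≤ᵇ⇒≤ _ _ (Equivalence.from T-≡ e)
    ... | false = insertBy-All k≤j h ∷ insertBy-sorted j ks s
      where
      k≤j : lookup u k ≤ lookup u j
      k≤j with ≤-total (lookup u k) (lookup u j)
      ... | inj₁ p = p
      ... | inj₂ p = contradiction (trans (sym (Equivalence.to T-≡ (≤⇒≤ᵇ p))) e) λ ()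

    cnt-insertBy : ∀ j ks y → cnt (insertBy u j ks) y ≡ unit j y + cnt ks y
    cnt-insertBy j [] y = refl
    cnt-insertBy j (k ∷ ks) y with lookup u j ≤ᵇ lookup u k
    ... | true  = refl
    ... | false = trans (cong (unit k y +_) (cnt-insertBy j ks y))
      (trans (sym (+-assoc (unit k y) _ _)) (trans (cong (_+ cnt ks y) (+-comm (unit k y) (unit j y))) (+-assoc (unit j y) _ _)))

    insertionSort : List (Fin n) → List (Fin n)
    insertionSort = List.foldr (insertBy u) []

    insertionSort-sorted : ∀ L → Sorted u (insertionSort L)
    insertionSort-sorted []      = []
    insertionSort-sorted (j ∷ L) = insertBy-sorted j _ (insertionSort-sorted L)

    cnt-insertionSort : ∀ L y → cnt (insertionSort L) y ≡ cnt L y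
    cnt-insertionSort []      y = refl
    cnt-insertionSort (j ∷ L) y = trans (cnt-insertBy j (insertionSort L) y) (cong (unit j y +_) (cnt-insertionSort L y))

  cnt-tabulate-∉ : ∀ {m n} (f : Fin m → Fin n) y → (∀ i → f i ≢ y) → cnt (V.toList (tabulate f)) y ≡ 0
  cnt-tabulate-∉ {zero}  f y h = refl
  cnt-tabulate-∉ {suc m} f y h = cong₂ _+_ (unit-≢ (h Fin.zero)) (cnt-tabulate-∉ (f ∘ Fin.suc) y (h ∘ Fin.suc))

  cnt-tabulate : ∀ {m n} (f : Fin m → Fin n) → (∀ {i j} → f i ≡ f j → i ≡ j) → ∀ i → cnt (V.toList (tabulate f)) (f i) ≡ 1
  cnt-tabulate {suc m} f inj Fin.zero = cong₂ _+_ (unit-refl (f Fin.zero))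
    (cnt-tabulate-∉ (f ∘ Fin.suc) (f Fin.zero) (λ i e → contradiction (inj e) λ ()))
  cnt-tabulate {suc m} f inj (Fin.suc i) = cong₂ _+_
    (unit-≢ {i = f Fin.zero} {f (Fin.suc i)} (λ e → contradiction (inj e) λ ()))
    (cnt-tabulate (f ∘ Fin.suc) (Fin.suc-injective ∘ inj) i)

  sortedSites-all : ∀ {n} (u : Word n) y → cnt (sortedSites u) y ≡ 1
  sortedSites-all {n} u y = trans (cnt-insertionSort u (V.toList (V.allFin n)) y) (cnt-tabulate (λ i → i) (λ e → e) y)

  sortedSites-sorted : ∀ {n} (u : Word n) → Sorted u (sortedSites u)
  sortedSites-sorted {n} u = insertionSort-sorted u (V.toList (V.allFin n))

  cnt-++ : ∀ {n} (xs ys : List (Fin n)) y → cnt (xs ++ ys) y ≡ cnt xs y + cnt ys y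
  cnt-++ []       ys y = refl
  cnt-++ (x ∷ xs) ys y = trans (cong (unit x y +_) (cnt-++ xs ys y)) (sym (+-assoc (unit x y) _ _))

  cnt-reverse : ∀ {n} (xs : List (Fin n)) y → cnt (reverse xs) y ≡ cnt xs y
  cnt-reverse []       y = refl
  cnt-reverse (x ∷ xs) y = trans (cong (λ L → cnt L y) (unfold-reverse x xs))
    (trans (cnt-++ (reverse xs) (x ∷ []) y) (trans (cong₂ _+_ (cnt-reverse xs y) (+-identityʳ (unit x y))) (+-comm (cnt xs y) _)))

  All-reverse : ∀ {a p} {A : Set a} {P : A → Set p} {xs} → All P xs → All P (reverse xs)
  All-reverse [] = []
  All-reverse {xs = x ∷ xs} (px ∷ pxs) = subst (All _) (sym (unfold-reverse x xs)) (All.++⁺ (All-reverse pxs) (px ∷ []))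

  AllPairs-reverse : ∀ {a ℓ} {A : Set a} {R : A → A → Set ℓ} {xs} → AllPairs R xs → AllPairs (flip R) (reverse xs)
  AllPairs-reverse [] = []
  AllPairs-reverse {xs = x ∷ xs} (px ∷ pxs) = subst (AllPairs _) (sym (unfold-reverse x xs))
    (AllPairs.++⁺ (AllPairs-reverse pxs) ([] ∷ []) (All.map (_∷ []) (All-reverse px)))

  sameBool-true : ∀ b → sameBool b true ≡ b
  sameBool-true true  = refl
  sameBool-true false = refl

  sameBool-false : ∀ b → sameBool b false ≡ not b
  sameBool-false true  = refl
  sameBool-false false = refl

  tot-ones : ∀ n → tot {n} (λ _ → 1) ≡ n
  tot-ones zero    = refl
  tot-ones (suc n) = cong suc (tot-ones n)

  tot-not≡ : ∀ {n} (f : Fin n → Bool) → tot (num ∘ not ∘ f) ≡ n ∸ tot (num ∘ f)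
  tot-not≡ {n} f = trans (sym (m+n∸m≡n (tot (num ∘ f)) _)) (cong (_∸ tot (num ∘ f)) (tot-not f))

  below : ∀ {n} → ℕ → Word n → Subset n
  below k = V.map (_<ᵇ k)

  ∣below∣ : ∀ {n} k (u : Word n) → ∣ below k u ∣ ≡ tot (λ y → num (lookup u y <ᵇ k))
  ∣below∣ k u = trans (sym (tot-bits (below k u))) (tot-cong λ y → cong num (lookup-map y (_<ᵇ k) u))

  ∣below∣-mono : ∀ {n} k (u : Word n) → ∣ below k u ∣ ≤ ∣ below (suc k) u ∣
  ∣below∣-mono k u = subst₂ _≤_ (sym (∣below∣ k u)) (sym (∣below∣ (suc k) u))
    (tot-mono λ y → num-sub {lookup u y <ᵇ k} {lookup u y <ᵇ suc k} 
      (λ e → <⇒<ᵇ-true (lookup u y) (suc k) (m<n⇒m<1+n (<ᵇ-true⇒< (lookup u y) k e))))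

  module Apply (n : ℕ) .{{_ : NonZero n}} (q : Subset n) (u : Word n) where
    open Queues n
    open Motion n

    module L = Greedy q false prev prev-injective (leftOf n) leftOf-path leftOf-all (suc ∘ lookup u)
    module R = Greedy q true next next-injective (rightOf n) rightOf-path rightOf-all (lookup u)

    phaseI-run : ∀ is v → phaseI n q u is v ≡ L.run is v
    phaseI-run []       v = refl
    phaseI-run (i ∷ is) v = phaseI-run is _

    phaseII-run : ∀ is v → phaseII n q u is v ≡ R.run is v
    phaseII-run []       v = refl
    phaseII-run (i ∷ is) v = phaseII-run is _

    s : List (Fin n)
    s = sortedSites u

    reverse-all : ∀ y → cnt (reverse s) y ≡ 1
    reverse-all y = trans (cnt-reverse s y) (sortedSites-all u y)

    oL≡ : ∀ y → L.o y ≡ not (lookup q y)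
    oL≡ y = sameBool-false (lookup q y)

    oR≡ : ∀ y → R.o y ≡ lookup q y
    oR≡ y = sameBool-true (lookup q y)

    tot-oL : tot (num ∘ L.o) ≡ n ∸ ∣ q ∣
    tot-oL = trans (tot-cong (cong num ∘ oL≡)) (trans (tot-not≡ (lookup q)) (cong (n ∸_) (tot-bits q)))

    tot-oR : tot (num ∘ R.o) ≡ ∣ q ∣
    tot-oR = trans (tot-cong (cong num ∘ oR≡)) (tot-bits q)

    v₁ v₂ : Vec (Maybe ℕ) n
    v₁ = L.run (take (n ∸ ∣ q ∣) (reverse s)) (replicate n nothing)
    v₂ = R.run (take ∣ q ∣ s) v₁

    v₁-empty : ∀ y → R.o y ≡ true → lookup v₁ y ≡ nothing
    v₁-empty y e = trans
      (L.run-closed (take (n ∸ ∣ q ∣) (reverse s)) (replicate n nothing) y (trans (oL≡ y) (cong not (trans (sym (oR≡ y)) e))))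
      (lookup-replicate y nothing)

    applyQueue≡ : applyQueue n q u ≡ V.map unMaybe v₂
    applyQueue≡ = cong (V.map unMaybe) (trans
      (phaseII-run (take ∣ q ∣ s) (phaseI n q u (take (n ∸ ∣ q ∣) (reverse s)) (replicate n nothing)))
      (cong (R.run (take ∣ q ∣ s)) (phaseI-run (take (n ∸ ∣ q ∣) (reverse s)) (replicate n nothing))))

    module PL (P : ℕ → Bool) (pf : L.Prefix P (reverse s)) =
      L.Phase P (reverse s) reverse-all pf (n ∸ ∣ q ∣) tot-oL (replicate n nothing) (λ y _ → lookup-replicate y nothing)

    module PR (P : ℕ → Bool) (pf : R.Prefix P s) =
      R.Phase P s (sortedSites-all u) pf ∣ q ∣ tot-oR v₁ v₁-empty

    always : ∀ {R : Fin n → Fin n → Set} {L} → AllPairs R L → AllPairs (λ _ _ → true ≡ true → true ≡ true) L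
    always = AllPairs.map (λ _ e → e)

    isJust : ∀ (m : Maybe ℕ) → maybe′ (λ _ → true) false m ≡ true → ∃ λ a → m ≡ just a
    isJust (just a) _ = a , refl

    -- The always-true predicate makes `final-big` say that all open sites are filled. Together with
    -- `filledR` it shows that the default value of `unMaybe` never enters.
    filledL : ∀ y → lookup q y ≡ false → ∃ λ a → lookup v₁ y ≡ just a
    filledL y qy = isJust (lookup v₁ y) (trans (cong (_∧ maybe′ (λ _ → true) false (lookup v₁ y)) (sym oy))
        (trans (PL.final-big (λ _ → true) (always (AllPairs-reverse (sortedSites-sorted u)))
                 (subst (n ∸ ∣ q ∣ ≤_) (sym (tot-ones n)) (m∸n≤m n ∣ q ∣)) y) oy))
      where
      oy : L.o y ≡ true
      oy = trans (oL≡ y) (cong not qy)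

    filledR : ∀ y → lookup q y ≡ true → ∃ λ a → lookup v₂ y ≡ just a
    filledR y qy = isJust (lookup v₂ y) (trans (cong (_∧ maybe′ (λ _ → true) false (lookup v₂ y)) (sym oy))
        (trans (PR.final-big (λ _ → true) (always (sortedSites-sorted u))
                 (subst (∣ q ∣ ≤_) (sym (tot-ones n)) (∣p∣≤n q)) y) oy))
      where
      oy : R.o y ≡ true
      oy = trans (oR≡ y) qy

    -- Phase I writes letters raised by one, and `high k (suc a)` reduces to `not (a <ᵇ k)`. This is
    -- the origin of the index shift in `below-big`.
    low high : ℕ → ℕ → Bool
    low k a  = a <ᵇ k
    high k a = not (a <ᵇ suc k)

    low-prefix : ∀ k → R.Prefix (low k) s
    low-prefix k = AllPairs.map (λ {i} {j} p e → <⇒<ᵇ-true (lookup u i) k (≤-<-trans p (<ᵇ-true⇒< (lookup u j) k e)))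
      (sortedSites-sorted u)

    high-prefix : ∀ k → L.Prefix (high k) (reverse s)
    high-prefix k = AllPairs.map
      (λ {i} {j} p e → mono (lookup u j) (lookup u i) p e) (AllPairs-reverse (sortedSites-sorted u))
      where
      mono : ∀ a b → a ≤ b → not (a <ᵇ k) ≡ true → not (b <ᵇ k) ≡ true
      mono a b p e with b <ᵇ k in bk
      ... | false = refl
      ... | true  = contradiction (trans (sym (cong not (<⇒<ᵇ-true a k (≤-<-trans p (<ᵇ-true⇒< b k bk))))) e) λ ()

    w : Word n
    w = applyQueue n q u

    lookup-below : ∀ k y → lookup (below k w) y ≡ (unMaybe (lookup v₂ y) <ᵇ k)
    lookup-below k y = trans (lookup-map y (_<ᵇ k) w) (cong (_<ᵇ k)
      (trans (cong (λ z → lookup z y) applyQueue≡) (lookup-map y unMaybe v₂)))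

    dR dL : ℕ → Fin n → Bool
    dR k = R.occ (low k) v₂
    dL k = L.occ (high k) v₁

    in-queue : ∀ k y → lookup q y ≡ true → lookup (below k w) y ≡ dR k y
    in-queue k y qy = let a , e = filledR y qy in trans (lookup-below k y) (trans (cong (λ m → unMaybe m <ᵇ k) e)
      (sym (cong₂ (λ b m → b ∧ maybe′ (low k) false m) (trans (oR≡ y) qy) e)))

    off-queue : ∀ k y → lookup q y ≡ false → lookup (below (suc k) w) y ≡ not (dL k y)
    off-queue k y qy = let a , e = filledL y qy in trans (lookup-below (suc k) y)
      (trans (cong (λ m → unMaybe m <ᵇ suc k) (trans (R.run-closed (take ∣ q ∣ s) v₁ y (trans (oR≡ y) qy)) e))
      (trans (sym (not-involutive _))
        (cong not (sym (cong₂ (λ b m → b ∧ maybe′ (high k) false m) (trans (oL≡ y) (cong not qy)) e)))))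

    dR-off : ∀ k y → lookup q y ≡ false → dR k y ≡ false
    dR-off k y qy = cong (_∧ maybe′ (low k) false (lookup v₂ y)) (trans (oR≡ y) qy)

    dL-off : ∀ k y → lookup q y ≡ true → dL k y ≡ false
    dL-off k y qy = cong (_∧ maybe′ (high k) false (lookup v₁ y)) (trans (oL≡ y) (cong not qy))

    dR-small : ∀ k → ∣ below k u ∣ ≤ ∣ q ∣ → tabulate (dR k) ≡ act q (below k u)
    dR-small k le =
      let Q , f , t = PR.final-small (low k) (low-prefix k) (subst (_≤ ∣ q ∣) (∣below∣ k u) le) in
      RightFlow.flow-act q (below k u) (tabulate (dR k)) Q
      (Flow-cong oR≡ (λ y → sym (lookup∘tabulate (dR k) y)) (λ y → cong num (sym (lookup-map y (_<ᵇ k) u))) f)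
      (trans (sym (tot-bits (tabulate (dR k)))) (trans (tot-cong (λ y → cong num (lookup∘tabulate (dR k) y)))
        (trans t (sym (∣below∣ k u)))))

    dR-big : ∀ k → ∣ q ∣ ≤ ∣ below k u ∣ → ∀ y → dR k y ≡ lookup q y
    dR-big k le y = trans (PR.final-big (low k) (low-prefix k) (subst (∣ q ∣ ≤_) (∣below∣ k u) le) y) (oR≡ y)

    high-total : ∀ k → tot (λ y → num (high k (suc (lookup u y)))) ≡ n ∸ ∣ below k u ∣
    high-total k = trans (tot-not≡ (λ y → lookup u y <ᵇ k)) (cong (n ∸_) (sym (∣below∣ k u)))

    dL-small : ∀ k → ∣ q ∣ ≤ ∣ below k u ∣ → tabulate (not ∘ dL k) ≡ act q (below k u)
    dL-small k le =
      let Q , f , t = PL.final-small (high k) (high-prefix k)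
                        (subst (_≤ n ∸ ∣ q ∣) (sym (high-total k)) (∸-monoʳ-≤ n le)) in
      LeftFlow.flow-act q (below k u) d Q
      (Flow-cong oL≡ (sym ∘ not-d) (λ y → cong (num ∘ not) (sym (lookup-map y (_<ᵇ k) u))) f)
      (∸-cancelˡ-≡ (∣p∣≤n d) (∣p∣≤n (below k u))
        (trans (cong (n ∸_) (sym (tot-bits d))) (trans (sym (tot-not≡ (lookup d)))
        (trans (tot-cong (λ y → cong num (not-d y))) (trans t (high-total k))))))
      where
      d : Subset n
      d = tabulate (not ∘ dL k)
      not-d : ∀ y → not (lookup d y) ≡ dL k y
      not-d y = trans (cong not (lookup∘tabulate (not ∘ dL k) y)) (not-involutive _)

    dL-big : ∀ k → ∣ below k u ∣ ≤ ∣ q ∣ → ∀ y → dL k y ≡ not (lookup q y)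
    dL-big k le y = trans (PL.final-big (high k) (high-prefix k)
      (subst (n ∸ ∣ q ∣ ≤_) (sym (high-total k)) (∸-monoʳ-≤ n le)) y) (oL≡ y)

    by-cases : ∀ {b : Bool} {A : Set} → (b ≡ true → A) → (b ≡ false → A) → A
    by-cases {true}  f g = f refl
    by-cases {false} f g = g refl

    -- The letters of u that are at least k are numerous enough to fill, once raised, all sites off
    -- the queue. Only phase II contributes letters below `suc k`.
    below-small : ∀ k → ∣ below (suc k) u ∣ ≤ ∣ q ∣ → below (suc k) w ≡ act q (below (suc k) u)
    below-small k le = trans (lookup-ext pointwise) (dR-small (suc k) le)
      where
      pointwise : ∀ y → lookup (below (suc k) w) y ≡ lookup (tabulate (dR (suc k))) y
      pointwise y = trans (by-cases {lookup q y} (in-queue (suc k) y) (λ qy → trans (off-queue k y qy)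
          (trans (cong not (trans (dL-big k (≤-trans (∣below∣-mono k u) le) y) (cong not qy))) (sym (dR-off (suc k) y qy)))))
        (sym (lookup∘tabulate (dR (suc k)) y))

    -- Dually, every queue site receives a letter below `suc k`, and only phase I decides about the
    -- rest.
    below-big : ∀ k → ∣ q ∣ ≤ ∣ below k u ∣ → below (suc k) w ≡ act q (below k u)
    below-big k le = trans (lookup-ext pointwise) (dL-small k le)
      where
      pointwise : ∀ y → lookup (below (suc k) w) y ≡ lookup (tabulate (not ∘ dL k)) y
      pointwise y = trans (by-cases {lookup q y}
          (λ qy → trans (in-queue (suc k) y qy)
            (trans (trans (dR-big (suc k) (≤-trans le (∣below∣-mono k u)) y) qy) (cong not (sym (dL-off k y qy)))))
          (off-queue k y))
        (sym (lookup∘tabulate (not ∘ dL k) y))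

    below-middle : ∀ k → ∣ below k u ∣ ≤ ∣ q ∣ → ∣ q ∣ ≤ ∣ below (suc k) u ∣ → below (suc k) w ≡ q
    below-middle k le ge = lookup-ext λ y → by-cases {lookup q y}
      (λ qy → trans (in-queue (suc k) y qy) (dR-big (suc k) ge y))
      (λ qy → trans (off-queue k y qy) (trans (cong not (dL-big k le y)) (not-involutive _)))

-- The exchange of two queues acting on words.

module WordExchange where

  open import Data.Nat using (_≤_; _<ᵇ_; z≤n)
  open import Data.Nat.Properties
  open QueueAction
  open GreedyFilling
  open Thresholds

  below-injective : ∀ {n} {v w : Word n} → (∀ k → below k v ≡ below k w) → v ≡ w
  below-injective {v = v} {w} h = lookup-ext same
    where
    at : ∀ k y → (lookup v y <ᵇ k) ≡ (lookup w y <ᵇ k)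
    at k y = trans (sym (lookup-map y (_<ᵇ k) v)) (trans (cong (λ s → lookup s y) (h k)) (lookup-map y (_<ᵇ k) w))
    same : ∀ y → lookup v y ≡ lookup w y
    same y with <-cmp (lookup v y) (lookup w y)
    ... | tri≈ _ e _ = e
    ... | tri< a<b _ _ = contradiction
      (<ᵇ-true⇒< (lookup w y) (lookup w y) (trans (sym (at (lookup w y) y)) (<⇒<ᵇ-true (lookup v y) (lookup w y) a<b))) (<-irrefl refl)
    ... | tri> _ _ b<a = contradiction
      (<ᵇ-true⇒< (lookup v y) (lookup v y) (trans (at (lookup v y) y) (<⇒<ᵇ-true (lookup w y) (lookup v y) b<a))) (<-irrefl refl)

  below-0 : ∀ {n} (v w : Word n) → below 0 v ≡ below 0 w
  below-0 v w = lookup-ext λ y → trans (lookup-map y (_<ᵇ 0) v) (sym (lookup-map y (_<ᵇ 0) w))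

  ∣below-0∣ : ∀ {n} (v : Word n) → ∣ below 0 v ∣ ≡ 0
  ∣below-0∣ {n} v = trans (∣below∣ 0 v) (tot-zero n)

  module Exchange (n : ℕ) .{{_ : NonZero n}} where
    open Queues n

    _∙_ : Subset n → Word n → Word n
    q ∙ w = applyQueue n q w

    small : ∀ q w k → ∣ below k w ∣ ≤ ∣ q ∣ → below k (q ∙ w) ≡ act q (below k w)
    -- Threshold 0 is not covered by `below-small`, but both sides are empty.
    small q w zero    le = trans (below-0 (q ∙ w) w) (sym (empty-act (below 0 w) (∣below-0∣ w)))
      where
      empty-act : ∀ B → ∣ B ∣ ≡ 0 → act q B ≡ B
      empty-act B e = lookup-ext λ y → num-injective (trans (vanishes (act q B) (trans (∣act∣ q B) e) y) (sym (vanishes B e y)))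
        where
        vanishes : ∀ p → ∣ p ∣ ≡ 0 → ∀ y → num (lookup p y) ≡ 0
        vanishes p e y = sym (tot-squeeze {f = λ _ → 0} (λ _ → z≤n) (subst (_≤ tot {n} (λ _ → 0)) (sym (trans (tot-bits p) e)) z≤n) y)
    small q w (suc k) le = Apply.below-small n q w k le

    ∣small∣ : ∀ q w k → ∣ below k w ∣ ≤ ∣ q ∣ → ∣ below k (q ∙ w) ∣ ≡ ∣ below k w ∣
    ∣small∣ q w k le = trans (cong ∣_∣ (small q w k le)) (∣act∣ q (below k w))

    big : ∀ q w k → ∣ q ∣ ≤ ∣ below k w ∣ → below (suc k) (q ∙ w) ≡ act q (below k w)
    big q w = Apply.below-big n q w

    ∣big∣ : ∀ q w k → ∣ q ∣ ≤ ∣ below k w ∣ → ∣ below (suc k) (q ∙ w) ∣ ≡ ∣ below k w ∣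
    ∣big∣ q w k le = trans (cong ∣_∣ (big q w k le)) (∣act∣ q (below k w))

    middle : ∀ q w k → ∣ below k w ∣ ≤ ∣ q ∣ → ∣ q ∣ ≤ ∣ below (suc k) w ∣ → below (suc k) (q ∙ w) ≡ q
    middle q w = Apply.below-middle n q w

    -- The sizes in the new chain are the old ones with that of q inserted. Needed in `at-p`, where
    -- the place of the next threshold set relative to the larger queue is unknown; `interlace-≤`
    -- serves `at-q` in the same way.
    interlace-≥ : ∀ q w k m → m ≤ ∣ q ∣ → m ≤ ∣ below k w ∣ → m ≤ ∣ below k (q ∙ w) ∣
    interlace-≥ q w zero m mq mk = ≤-trans mk (≤-reflexive (trans (∣below-0∣ w) (sym (∣below-0∣ (q ∙ w)))))
    interlace-≥ q w (suc k) m mq mk with ≤-total ∣ below (suc k) w ∣ ∣ q ∣ | ≤-total ∣ below k w ∣ ∣ q ∣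
    ... | inj₁ le | _       = ≤-trans mk (≤-reflexive (sym (∣small∣ q w (suc k) le)))
    ... | inj₂ ge | inj₁ le = ≤-trans mq (≤-reflexive (sym (cong ∣_∣ (middle q w k le ge))))
    ... | inj₂ _  | inj₂ ge = ≤-trans (≤-trans mq ge) (≤-reflexive (sym (∣big∣ q w k ge)))

    interlace-≤ : ∀ q w k m → ∣ q ∣ ≤ m → ∣ below k w ∣ ≤ m → ∣ below (suc k) (q ∙ w) ∣ ≤ m
    interlace-≤ q w k m qm km with ≤-total ∣ below (suc k) w ∣ ∣ q ∣ | ≤-total ∣ below k w ∣ ∣ q ∣
    ... | inj₁ le | _       = ≤-trans (≤-reflexive (∣small∣ q w (suc k) le)) (≤-trans le qm)
    ... | inj₂ ge | inj₁ le = ≤-trans (≤-reflexive (cong ∣_∣ (middle q w k le ge))) qm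
    ... | inj₂ _  | inj₂ ge = ≤-trans (≤-reflexive (∣big∣ q w k ge)) km

    module _ (p q : Subset n) (w : Word n) (p≤q : ∣ p ∣ ≤ ∣ q ∣) where

      private
        p′ = swap₁ p q
        q′ = swap₂ p q
        ∣p′∣ = ∣swap₁∣ p q
        ∣q′∣ = ∣swap₂∣ p q

        q′≤ : ∀ {m} → ∣ p ∣ ≤ m → ∣ q′ ∣ ≤ m
        q′≤ {m} = subst (_≤ m) (sym ∣q′∣)
        p′≤ : ∀ {m} → ∣ q ∣ ≤ m → ∣ p′ ∣ ≤ m
        p′≤ {m} = subst (_≤ m) (sym ∣p′∣)
        ≤q′ : ∀ {m} → m ≤ ∣ p ∣ → m ≤ ∣ q′ ∣
        ≤q′ {m} = subst (m ≤_) (sym ∣q′∣)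
        ≤p′ : ∀ {m} → m ≤ ∣ q ∣ → m ≤ ∣ p′ ∣
        ≤p′ {m} = subst (m ≤_) (sym ∣p′∣)

      Goal : ℕ → Set
      Goal k = below k (q ∙ (p ∙ w)) ≡ below k (q′ ∙ (p′ ∙ w))

      below-p : ∀ k → ∣ below k w ∣ ≤ ∣ p ∣ → Goal k
      below-p k le = trans lhs (trans (act-swap p q (below k w)) (sym rhs))
        where
        le′ = ≤-trans le p≤q
        lhs : below k (q ∙ (p ∙ w)) ≡ act q (act p (below k w))
        lhs = trans (small q (p ∙ w) k (subst (_≤ ∣ q ∣) (sym (∣small∣ p w k le)) le′)) (cong (act q) (small p w k le))
        rhs : below k (q′ ∙ (p′ ∙ w)) ≡ act q′ (act p′ (below k w))
        rhs = trans (small q′ (p′ ∙ w) k (subst (_≤ ∣ q′ ∣) (sym (∣small∣ p′ w k (≤p′ le′))) (≤q′ le)))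
                    (cong (act q′) (small p′ w k (≤p′ le′)))

      -- The new member of size ∣ p ∣. On the left p is inserted and then moved by q, giving
      -- `act q p`, which is q′ by definition; on the right q′ is inserted last.
      at-p : ∀ k → ∣ below k w ∣ ≤ ∣ p ∣ → ∣ p ∣ ≤ ∣ below (suc k) w ∣ → Goal (suc k)
      at-p k le ge = trans lhs (sym rhs)
        where
        mid = middle p w k le ge
        lhs : below (suc k) (q ∙ (p ∙ w)) ≡ q′
        lhs = trans (small q (p ∙ w) (suc k) (subst (λ s → ∣ s ∣ ≤ ∣ q ∣) (sym mid) p≤q)) (cong (act q) mid)
        rhs : below (suc k) (q′ ∙ (p′ ∙ w)) ≡ q′
        rhs = middle q′ (p′ ∙ w) k
          (subst (_≤ ∣ q′ ∣) (sym (∣small∣ p′ w k (≤p′ (≤-trans le p≤q)))) (≤q′ le))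
          (interlace-≥ p′ w (suc k) ∣ q′ ∣ (≤p′ (q′≤ p≤q)) (q′≤ ge))

      between : ∀ k → ∣ p ∣ ≤ ∣ below k w ∣ → ∣ below k w ∣ ≤ ∣ q ∣ → Goal (suc k)
      between k ge le = trans lhs (trans (act-swap p q (below k w)) (sym rhs))
        where
        lhs : below (suc k) (q ∙ (p ∙ w)) ≡ act q (act p (below k w))
        lhs = trans (small q (p ∙ w) (suc k) (subst (_≤ ∣ q ∣) (sym (∣big∣ p w k ge)) le)) (cong (act q) (big p w k ge))
        rhs : below (suc k) (q′ ∙ (p′ ∙ w)) ≡ act q′ (act p′ (below k w))
        rhs = trans (big q′ (p′ ∙ w) k (subst (∣ q′ ∣ ≤_) (sym (∣small∣ p′ w k (≤p′ le))) (q′≤ ge)))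
                    (cong (act q′) (small p′ w k (≤p′ le)))

      -- The new member of size ∣ q ∣. On the left q is inserted last; on the right p′ is inserted
      -- and then moved by q′, which returns q because the exchange is an involution. The index
      -- rises by two since both queues have been passed.
      at-q : ∀ k → ∣ below k w ∣ ≤ ∣ q ∣ → ∣ q ∣ ≤ ∣ below (suc k) w ∣ → Goal (suc (suc k))
      at-q k le ge = trans lhs (sym rhs)
        where
        lhs : below (suc (suc k)) (q ∙ (p ∙ w)) ≡ q
        lhs = middle q (p ∙ w) (suc k)
          (interlace-≤ p w k ∣ q ∣ p≤q le)
          (subst (∣ q ∣ ≤_) (sym (∣big∣ p w (suc k) (≤-trans p≤q ge))) ge)
        mid = middle p′ w k (≤p′ le) (p′≤ ge)
        rhs : below (suc (suc k)) (q′ ∙ (p′ ∙ w)) ≡ q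
        rhs = trans (big q′ (p′ ∙ w) (suc k) (subst (λ s → ∣ q′ ∣ ≤ ∣ s ∣) (sym mid) (≤p′ (q′≤ p≤q))))
          (trans (cong (act q′) mid) (swap₂-involutive p q))

      above-q : ∀ k → ∣ q ∣ ≤ ∣ below k w ∣ → Goal (suc (suc k))
      above-q k ge = trans lhs (trans (act-swap p q (below k w)) (sym rhs))
        where
        ge′ = ≤-trans p≤q ge
        lhs : below (suc (suc k)) (q ∙ (p ∙ w)) ≡ act q (act p (below k w))
        lhs = trans (big q (p ∙ w) (suc k) (subst (∣ q ∣ ≤_) (sym (∣big∣ p w k ge′)) ge)) (cong (act q) (big p w k ge′))
        rhs : below (suc (suc k)) (q′ ∙ (p′ ∙ w)) ≡ act q′ (act p′ (below k w))
        rhs = trans (big q′ (p′ ∙ w) (suc k) (subst (∣ q′ ∣ ≤_) (sym (∣big∣ p′ w k (p′≤ ge))) (q′≤ ge′)))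
                    (cong (act q′) (big p′ w k (p′≤ ge)))

      exchange-≤ : q ∙ (p ∙ w) ≡ q′ ∙ (p′ ∙ w)
      exchange-≤ = below-injective goal
        where
        late : ∀ k → ∣ p ∣ ≤ ∣ below k w ∣ → Goal (suc k)
        late k ge with ≤-total ∣ below k w ∣ ∣ q ∣
        late k ge | inj₁ le = between k ge le
        -- The empty threshold set is no larger than q, so this case is not beyond q after all.
        late zero ge | inj₂ _ = between 0 ge (subst (_≤ ∣ q ∣) (sym (∣below-0∣ w)) z≤n)
        late (suc k) ge | inj₂ ge′ with ≤-total ∣ below k w ∣ ∣ q ∣
        ... | inj₁ le = at-q k le ge′
        ... | inj₂ ge″ = above-q k ge″
        goal : ∀ k → Goal k
        goal zero    = below-0 _ _
        goal (suc k) with ≤-total ∣ below (suc k) w ∣ ∣ p ∣ | ≤-total ∣ below k w ∣ ∣ p ∣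
        ... | inj₁ le | _       = below-p (suc k) le
        ... | inj₂ ge | inj₁ le = at-p k le ge
        ... | inj₂ _  | inj₂ ge = late k ge

    -- If p is the larger queue, the exchanged pair has its sizes in the right order, and the
    -- involution leads back.
    exchange : ∀ p q w → q ∙ (p ∙ w) ≡ swap₂ p q ∙ (swap₁ p q ∙ w)
    exchange p q w with ≤-total ∣ p ∣ ∣ q ∣
    ... | inj₁ le = exchange-≤ p q w le
    ... | inj₂ ge = sym (trans
      (exchange-≤ (swap₁ p q) (swap₂ p q) w (subst₂ _≤_ (sym (∣swap₁∣ p q)) (sym (∣swap₂∣ p q)) ge))
      (cong₂ (λ a b → a ∙ (b ∙ w)) (swap₂-involutive p q) (swap₁-involutive p q)))

-- Reordering the queue sizes in the spectral weight.

module SpectralWeight where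

  open QueueAction
  open WordExchange

  -- Turns a bijection of a finite type into a reordering of its enumeration, hence into a
  -- reindexing of sums.
  complete⇒↭ : ∀ {a} {A : Set a} {xs ys : List A} → Unique xs → Unique ys →
               (∀ x → x ∈ xs) → (∀ x → x ∈ ys) → xs ↭ ys
  complete⇒↭ ux uy cx cy = ∼bag⇒↭ (unique∧set⇒bag ux uy (mk⇔ (λ _ → cy _) (λ _ → cx _)))

  tabulate-↭ : ∀ {a} {A : Set a} {k} (f : Fin k → A) (σ : Permutation′ k) →
               List.tabulate (λ i → f (σ ⟨$⟩ʳ i)) ↭ List.tabulate f
  tabulate-↭ f σ = Perm.↭-trans (Perm.↭-reflexive (≡.sym (map-tabulate (σ ⟨$⟩ʳ_) f)))
    (Perm.↭-trans (↭-map⁺ f (complete⇒↭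
        (Unique.tabulate⁺ λ {i} {j} e → ≡.trans (≡.sym (inverseˡ σ)) (≡.trans (cong (σ ⟨$⟩ˡ_) e) (inverseˡ σ)))
        (Unique.tabulate⁺ λ e → e)
        (λ i → subst (_∈ List.tabulate (σ ⟨$⟩ʳ_)) (inverseʳ σ) (∈-tabulate⁺ (σ ⟨$⟩ˡ i)))
        (λ i → ∈-tabulate⁺ i)))
      (Perm.↭-reflexive (map-tabulate (λ i → i) f)))

  allSubsets-complete : ∀ {n} (q : Subset n) → q ∈ allSubsets n
  allSubsets-complete [] = here refl
  allSubsets-complete {suc n} (b ∷ q) = extend b (allSubsets-complete q)
    where
    extend : ∀ b {q} {qs : List (Subset n)} → q ∈ qs → (b ∷ q) ∈ concatMap (λ s → (true ∷ s) ∷ (false ∷ s) ∷ []) qs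
    extend true  (here refl) = here refl
    extend false (here refl) = there (here refl)
    extend b     (there m)   = there (there (extend b m))

  allSubsets-unique : ∀ n → Unique (allSubsets n)
  allSubsets-unique zero    = [] ∷ []
  allSubsets-unique (suc n) = extend (allSubsets-unique n)
    where
    fresh : ∀ b {q} {qs : List (Subset n)} → All (q ≢_) qs → All ((b ∷ q) ≢_) (concatMap (λ s → (true ∷ s) ∷ (false ∷ s) ∷ []) qs)
    fresh b []       = []
    fresh b (h ∷ hs) = (h ∘ V.∷-injectiveʳ) ∷ (h ∘ V.∷-injectiveʳ) ∷ fresh b hs
    extend : ∀ {qs : List (Subset n)} → Unique qs → Unique (concatMap (λ s → (true ∷ s) ∷ (false ∷ s) ∷ []) qs)
    extend []       = []
    extend (h ∷ hs) = ((λ ()) ∷ fresh true h) ∷ fresh false h ∷ extend hs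

  module Sums {c ℓ : Level} (R : CommutativeSemiring c ℓ) where
    open CommutativeSemiring R renaming (refl to ≈-refl; sym to ≈-sym; trans to ≈-trans)
    open import Relation.Binary.Reasoning.Setoid setoid

    ∑ : ∀ {a} {A : Set a} → List A → (A → Carrier) → Carrier
    ∑ xs f = List.foldr _+_ 0# (map f xs)

    ∑-cong : ∀ {a} {A : Set a} (xs : List A) {f g} → (∀ x → f x ≈ g x) → ∑ xs f ≈ ∑ xs g
    ∑-cong []       h = ≈-refl
    ∑-cong (x ∷ xs) h = +-cong (h x) (∑-cong xs h)

    ∑-zero : ∀ {a} {A : Set a} (xs : List A) → ∑ xs (λ _ → 0#) ≈ 0#
    ∑-zero []       = ≈-refl
    ∑-zero (x ∷ xs) = ≈-trans (+-identityˡ _) (∑-zero xs)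

    ∑-*ˡ : ∀ {a} {A : Set a} r (xs : List A) f → ∑ xs (λ x → r * f x) ≈ r * ∑ xs f
    ∑-*ˡ r []       f = ≈-sym (zeroʳ r)
    ∑-*ˡ r (x ∷ xs) f = ≈-trans (+-congˡ (∑-*ˡ r xs f)) (≈-sym (distribˡ r _ _))

    ∑-++ : ∀ {a} {A : Set a} (xs ys : List A) f → ∑ (xs ++ ys) f ≈ ∑ xs f + ∑ ys f
    ∑-++ []       ys f = ≈-sym (+-identityˡ _)
    ∑-++ (x ∷ xs) ys f = ≈-trans (+-congˡ (∑-++ xs ys f)) (≈-sym (+-assoc _ _ _))

    ∑-map : ∀ {a b} {A : Set a} {B : Set b} (g : A → B) xs f → ∑ (map g xs) f ≈ ∑ xs (f ∘ g)
    ∑-map g []       f = ≈-refl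
    ∑-map g (x ∷ xs) f = +-congˡ (∑-map g xs f)

    ∑-concatMap : ∀ {a b} {A : Set a} {B : Set b} (g : A → List B) xs f →
                  ∑ (concatMap g xs) f ≈ ∑ xs (λ x → ∑ (g x) f)
    ∑-concatMap g []       f = ≈-refl
    ∑-concatMap g (x ∷ xs) f = ≈-trans (∑-++ (g x) (concatMap g xs) f) (+-congˡ (∑-concatMap g xs f))

    ∑-pairs : ∀ {a b} {A : Set a} {B : Set b} (xs : List A) (ys : List B) f →
              ∑ (cartesianProduct xs ys) f ≈ ∑ xs (λ x → ∑ ys (λ y → f (x , y)))
    ∑-pairs []       ys f = ≈-refl
    ∑-pairs (x ∷ xs) ys f = ≈-trans (∑-++ (map (x ,_) ys) (cartesianProduct xs ys) f)
      (+-cong (∑-map (x ,_) ys f) (∑-pairs xs ys f))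

    ∑-filter : ∀ {a} {A : Set a} (b : A → Bool) xs f →
               ∑ (filter (λ x → T? (b x)) xs) f ≈ ∑ xs (λ x → if b x then f x else 0#)
    ∑-filter b []       f = ≈-refl
    ∑-filter b (x ∷ xs) f with b x
    ... | true  = +-congˡ (∑-filter b xs f)
    ... | false = ≈-trans (∑-filter b xs f) (≈-sym (+-identityˡ _))

    ∑-↭ : ∀ {a} {A : Set a} {xs ys : List A} f → xs ↭ ys → ∑ xs f ≈ ∑ ys f
    ∑-↭ f Perm.refl          = ≈-refl
    ∑-↭ f (Perm.prep x p)    = +-congˡ (∑-↭ f p)
    ∑-↭ f (Perm.swap x y p)  = ≈-trans (≈-sym (+-assoc _ _ _))
      (≈-trans (+-cong (+-comm _ _) (∑-↭ f p)) (+-assoc _ _ _))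
    ∑-↭ f (Perm.trans p p′)  = ≈-trans (∑-↭ f p) (∑-↭ f p′)

    interchange : ∀ a b c d → (a * b) * (c * d) ≈ (a * c) * (b * d)
    interchange a b c d = begin
      (a * b) * (c * d) ≈⟨ *-assoc a b (c * d) ⟩
      a * (b * (c * d)) ≈⟨ *-congˡ (≈-sym (*-assoc b c d)) ⟩
      a * ((b * c) * d) ≈⟨ *-congˡ (*-congʳ (*-comm b c)) ⟩
      a * ((c * b) * d) ≈⟨ *-congˡ (*-assoc c b d) ⟩
      a * (c * (b * d)) ≈⟨ ≈-sym (*-assoc a c (b * d)) ⟩
      (a * c) * (b * d) ∎

    module _ (n : ℕ) .{{_ : NonZero n}} (x : Fin n → Carrier) (u : Word n) where
      open Queues n
      open Exchange n

      wt : Subset n → Carrier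
      wt = wtQ R x

      factor : Fin n → Bool → Carrier
      factor i b = if b then x i else 1#

      factor-swap : ∀ i a b a′ b′ → bit a′ ℤ.+ bit b′ ≡ bit a ℤ.+ bit b →
                    factor i a * factor i b ≈ factor i a′ * factor i b′
      factor-swap i true  true  true  true  _ = ≈-refl
      factor-swap i true  false true  false _ = ≈-refl
      factor-swap i true  false false true  _ = *-comm _ _
      factor-swap i false true  true  false _ = *-comm _ _
      factor-swap i false true  false true  _ = ≈-refl
      factor-swap i false false false false _ = ≈-refl
      factor-swap i true  true  true  false ()
      factor-swap i true  true  false false ()
      factor-swap i false false true  true  ()
      factor-swap i false false false true  ()

      -- Site by site the two queues contain the same number of elements before and after, so the
      -- two factors there are at most transposed.
      product-swap : ∀ {m} (is : Vec (Fin n) m) (a b a′ b′ : Vec Bool m) →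
        (∀ j → bit (lookup a′ j) ℤ.+ bit (lookup b′ j) ≡ bit (lookup a j) ℤ.+ bit (lookup b j)) →
        V.foldr _ _*_ 1# (V.zipWith factor is a) * V.foldr _ _*_ 1# (V.zipWith factor is b) ≈
        V.foldr _ _*_ 1# (V.zipWith factor is a′) * V.foldr _ _*_ 1# (V.zipWith factor is b′)
      product-swap []       []      []      []        []        h = ≈-refl
      product-swap (i ∷ is) (a ∷ as) (b ∷ bs) (a′ ∷ as′) (b′ ∷ bs′) h =
        ≈-trans (interchange _ _ _ _)
        (≈-trans (*-cong (factor-swap i a b a′ b′ (h Fin.zero)) (product-swap is as bs as′ bs′ (h ∘ Fin.suc)))
                 (interchange _ _ _ _))

      wt-swap : ∀ p q → wt p * wt q ≈ wt (swap₁ p q) * wt (swap₂ p q)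
      wt-swap p q = product-swap (V.allFin n) p q (swap₁ p q) (swap₂ p q) λ j →
        subst (λ i → bit (lookup (swap₁ p q) i) ℤ.+ bit (lookup (swap₂ p q) i) ≡ bit (lookup p i) ℤ.+ bit (lookup q i))
          (site-toℕ j) (hat-swap-sum p q (toℕ j))

      -- σ matters only through the list of queue sizes. Recursion on this list, with the word as a
      -- parameter, lets two neighbouring queues be exchanged in front of any tail.
      weight : List ℕ → Word n → Carrier
      weight []       w = if wordEq w u then 1# else 0#
      weight (t ∷ ts) w = ∑ (allSubsets n) λ q → if ∣ q ∣ ≡ᵇ t then wt q * weight ts (q ∙ w) else 0#

      if-cong : ∀ b {r s : Carrier} → r ≈ s → (if b then r else 0#) ≈ (if b then s else 0#)
      if-cong true  h = h
      if-cong false h = ≈-refl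

      swap : Subset n × Subset n → Subset n × Subset n
      swap (p , q) = swap₁ p q , swap₂ p q

      swap-involutive : ∀ a → swap (swap a) ≡ a
      swap-involutive (p , q) = cong₂ _,_ (swap₁-involutive p q) (swap₂-involutive p q)

      swap-injective : ∀ {a b} → swap a ≡ swap b → a ≡ b
      swap-injective {a} {b} e = ≡.trans (≡.sym (swap-involutive a)) (≡.trans (cong swap e) (swap-involutive b))

      pairs : List (Subset n × Subset n)
      pairs = cartesianProduct (allSubsets n) (allSubsets n)

      pairs-complete : ∀ a → a ∈ pairs
      pairs-complete (p , q) = ∈-cartesianProduct⁺ (allSubsets-complete p) (allSubsets-complete q)

      pairs-unique : Unique pairs
      pairs-unique = Unique.cartesianProduct⁺ (allSubsets-unique n) (allSubsets-unique n)

      swap-pairs : map swap pairs ↭ pairs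
      swap-pairs = complete⇒↭ (Unique.map⁺ swap-injective pairs-unique) pairs-unique
        (λ a → subst (_∈ map swap pairs) (swap-involutive a) (∈-map⁺ swap (pairs-complete (swap a)))) pairs-complete

      pairTerm : ℕ → ℕ → List ℕ → Word n → Subset n × Subset n → Carrier
      pairTerm s t ts w (p , q) =
        if (∣ p ∣ ≡ᵇ s) ∧ (∣ q ∣ ≡ᵇ t) then (wt p * wt q) * weight ts (q ∙ (p ∙ w)) else 0#

      weight-pairs : ∀ s t ts w → weight (s ∷ t ∷ ts) w ≈ ∑ pairs (pairTerm s t ts w)
      weight-pairs s t ts w = ≈-trans (∑-cong (allSubsets n) row) (≈-sym (∑-pairs (allSubsets n) (allSubsets n) (pairTerm s t ts w)))
        where
        row : ∀ p → (if ∣ p ∣ ≡ᵇ s then wt p * weight (t ∷ ts) (p ∙ w) else 0#) ≈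
                    ∑ (allSubsets n) (λ q → pairTerm s t ts w (p , q))
        row p with ∣ p ∣ ≡ᵇ s
        ... | false = ≈-sym (∑-zero (allSubsets n))
        ... | true  = ≈-trans (≈-sym (∑-*ˡ (wt p) (allSubsets n) _)) (∑-cong (allSubsets n) cell)
          where
          cell : ∀ q → wt p * (if ∣ q ∣ ≡ᵇ t then wt q * weight ts (q ∙ (p ∙ w)) else 0#) ≈
                       (if ∣ q ∣ ≡ᵇ t then (wt p * wt q) * weight ts (q ∙ (p ∙ w)) else 0#)
          cell q with ∣ q ∣ ≡ᵇ t
          ... | true  = ≈-sym (*-assoc _ _ _)
          ... | false = zeroʳ _

      pairTerm-swap : ∀ s t ts w a → pairTerm s t ts w a ≈ pairTerm t s ts w (swap a)
      pairTerm-swap s t ts w (p , q) = ≈-trans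
        (if-cong ((∣ p ∣ ≡ᵇ s) ∧ (∣ q ∣ ≡ᵇ t))
          (*-cong (wt-swap p q) (reflexive (cong (weight ts) (exchange p q w)))))
        (reflexive (cong (λ b → if b then (wt (swap₁ p q) * wt (swap₂ p q)) * weight ts (swap₂ p q ∙ (swap₁ p q ∙ w)) else 0#)
          (≡.trans (∧-comm (∣ p ∣ ≡ᵇ s) (∣ q ∣ ≡ᵇ t))
            (≡.sym (cong₂ (λ a b → (a ≡ᵇ t) ∧ (b ≡ᵇ s)) (∣swap₁∣ p q) (∣swap₂∣ p q))))))

      -- The sum over pairs of queues is reindexed by the involution, which trades the two size
      -- conditions and fixes both the weight and the resulting word.
      weight-swap : ∀ s t ts w → weight (s ∷ t ∷ ts) w ≈ weight (t ∷ s ∷ ts) w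
      weight-swap s t ts w = begin
        weight (s ∷ t ∷ ts) w                 ≈⟨ weight-pairs s t ts w ⟩
        ∑ pairs (pairTerm s t ts w)           ≈⟨ ∑-cong pairs (pairTerm-swap s t ts w) ⟩
        ∑ pairs (pairTerm t s ts w ∘ swap)    ≈⟨ ∑-map swap pairs (pairTerm t s ts w) ⟨
        ∑ (map swap pairs) (pairTerm t s ts w) ≈⟨ ∑-↭ (pairTerm t s ts w) swap-pairs ⟩
        ∑ pairs (pairTerm t s ts w)           ≈⟨ weight-pairs t s ts w ⟨
        weight (t ∷ s ∷ ts) w                 ∎

      weight-prep : ∀ t ts ts′ → (∀ w → weight ts w ≈ weight ts′ w) → ∀ w → weight (t ∷ ts) w ≈ weight (t ∷ ts′) w
      weight-prep t ts ts′ h w = ∑-cong (allSubsets n) λ q → if-cong (∣ q ∣ ≡ᵇ t) (*-congˡ (h (q ∙ w)))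

      weight-↭ : ∀ {ts ts′} → ts ↭ ts′ → ∀ w → weight ts w ≈ weight ts′ w
      weight-↭ Perm.refl           w = ≈-refl
      weight-↭ {_ ∷ ts} {_ ∷ ts′} (Perm.prep t p) w = weight-prep t ts ts′ (weight-↭ p) w
      weight-↭ {_ ∷ _ ∷ ts} {_ ∷ _ ∷ ts′} (Perm.swap s t p) w =
        ≈-trans (weight-swap s t ts w) (weight-prep t (s ∷ ts) (s ∷ ts′) (weight-prep s ts ts′ (weight-↭ p)) w)
      weight-↭ (Perm.trans p p′)   w = ≈-trans (weight-↭ p w) (weight-↭ p′ w)

      fits : ∀ {m k} → (Fin m → ℕ) → Vec (Fin m) k → Vec (Subset n) k → Bool
      fits f is qs = V.foldr _ _∧_ true (V.zipWith (λ i q → ∣ q ∣ ≡ᵇ f i) is qs)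

      term : ∀ {m k} → (Fin m → ℕ) → (Fin k → Fin m) → Word n → Vec (Subset n) k → Carrier
      term f h w qs = if fits f (V.tabulate h) qs ∧ wordEq (applyMLQ n qs w) u then wtMLQ R x qs else 0#

      -- An arbitrary index map `h` is needed for the induction: the tail of the enumeration of
      -- `Fin (suc k)` is tabulated by `Fin.suc` and is not itself an enumeration.
      ∑-term : ∀ {m} k (f : Fin m → ℕ) (h : Fin k → Fin m) w →
               ∑ (allSeqs n k) (term f h w) ≈ weight (List.tabulate (f ∘ h)) w
      ∑-term zero    f h w = +-identityʳ _
      ∑-term (suc k) f h w = ≈-trans
        (∑-concatMap (λ q → map (q ∷_) (allSeqs n k)) (allSubsets n) (term f h w))
        (∑-cong (allSubsets n) λ q → ≈-trans (∑-map (q ∷_) (allSeqs n k) (term f h w)) (row q))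
        where
        row : ∀ q → ∑ (allSeqs n k) (λ qs → term f h w (q ∷ qs)) ≈
                    (if ∣ q ∣ ≡ᵇ f (h Fin.zero) then wt q * weight (List.tabulate (f ∘ h ∘ Fin.suc)) (q ∙ w) else 0#)
        row q with ∣ q ∣ ≡ᵇ f (h Fin.zero)
        ... | false = ∑-zero (allSeqs n k)
        ... | true  = ≈-trans (∑-cong (allSeqs n k) pull) (≈-trans (∑-*ˡ (wt q) (allSeqs n k) (term f (h ∘ Fin.suc) (q ∙ w)))
                        (*-congˡ (∑-term k f (h ∘ Fin.suc) (q ∙ w))))
          where
          pull : ∀ qs → (if fits f (V.tabulate (h ∘ Fin.suc)) qs ∧ wordEq (applyMLQ n qs (q ∙ w)) u
                         then wt q * wtMLQ R x qs else 0#) ≈ wt q * term f (h ∘ Fin.suc) (q ∙ w) qs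
          pull qs with fits f (V.tabulate (h ∘ Fin.suc)) qs ∧ wordEq (applyMLQ n qs (q ∙ w)) u
          ... | true  = ≈-refl
          ... | false = ≈-sym (zeroʳ _)

      sw≈weight : ∀ σ → sw R n x u σ ≈ weight (List.tabulate (λ i → p u (suc (toℕ (σ ⟨$⟩ʳ i))))) (ones n)
      sw≈weight σ = ≈-trans
        (∑-filter (λ qs → sizesOK u σ qs ∧ wordEq (applyMLQ n qs (ones n)) u) (allSeqs n (classes u ∸ 1)) (wtMLQ R x))
        (∑-term (classes u ∸ 1) (λ i → p u (suc (toℕ (σ ⟨$⟩ʳ i)))) (λ i → i) (ones n))

theorem3p1 : (n : ℕ) .{{_ : NonZero n}} (u : Word n) → Packed u
    → (σ : Permutation′ (classes u ∸ 1))
    → {c ℓ : Level} (R : CommutativeSemiring c ℓ)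
    → (x : Fin n → CommutativeSemiring.Carrier R)
    → CommutativeSemiring._≈_ R (sw R n x u σ) (sw R n x u id)
theorem3p1 n u _ σ R x =
  R.trans (sw≈weight n x u σ)
    -- σ merely permutes the list of sizes, a product of adjacent transpositions.
    (R.trans (weight-↭ n x u (SpectralWeight.tabulate-↭ (λ i → p u (suc (toℕ i))) σ) (ones n))
           (R.sym (sw≈weight n x u id)))
  where
  module R = CommutativeSemiring R
  open SpectralWeight.Sums R
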